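{- Let $G$, $\{f_v\}_{v\in V}$, $\mathcal{P}$, $T$, $\varepsilon$, $\mathbf{x}$ be an input of the Threshold Blocking problem, let $\epsilon\in(0,1)$ be the parameter of the Threshold Expansion algorithm, and suppose that the initial value $M_0$ of $M$ in the algorithm satisfies $M_0\ge \frac{r_{\mathcal{P},\mathbf{w},v}(y)}{y}$ for all $\mathbf{w}\ge\mathbf{x}$, $v\in V$ and $y>0$. If $\mathbf{s}$ is the additional impact vector returned by Threshold Expansion and $\mathbf{s}^*$ is an optimal vector (i.e. of minimum $\|\mathbf{s}^*\|$) making $d_{\mathbf{x}+\mathbf{s}^*}(p)\ge T$ for all $p\in\mathcal{P}$, then $$\|\mathbf{s}\|\le \frac{\ln\big(|\mathcal{P}|\,\varepsilon^{ -1}\big)+1}{1-\epsilon}\,\|\mathbf{s}^*\|.$$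
   Context: $G=(V,E)$ is a directed graph with $|V|=n$; each node $v$ has a monotone non-decreasing function $f_v:\mathbb{R}_{\ge0}\to\mathbb{R}_{\ge0}$; $T$ is a threshold. Impact vectors are nonnegative vectors indexed by $V$, with $\|\mathbf{x}\|=\sum_v x_v$; inequalities between vectors are entrywise. A path is identified with its sequence of nodes; the length of $p$ under $\mathbf{x}$ is $d_{\mathbf{x}}(p)=\min(\sum_{v\in p}f_v(x_v),T)$. Given a target set $S$ of pairs of nodes, a feasible path is a path visiting no node more than once, connecting a pair in $S$, with $\sum_{v\in p}f_v(0)<T$. Threshold Blocking problem: given a finite set $\mathcal{P}$ of feasible paths with $d_{\mathbf{x}}(p)<T$ for all $p\in\mathcal P$, and a current impact vector $\mathbf{x}$, find a nonnegative vector $\mathbf{s}$ with minimum $\|\mathbf{s}\|$ such that $d_{\mathbf{x}+\mathbf{s}}(p)\ge T$ for all $p\in\mathcal{P}$. The algorithm is given an accuracy $\varepsilon\in(0,1)$ (distinct from the parameter $\epsilon$) and only guarantees $d_{\mathbf{x}+\mathbf{s}}(p)\ge T(1-\varepsilon)$ for all $p\in\mathcal{P}$. $\langle v,y\rangle$ denotes the vector with value $y$ at entry $v$ and $0$ elsewhere. For a path set $P$, a vector $\mathbf{w}$ and a node $v$, $r_{P,\mathbf{w},v}(y)=\sum_{p\in P}\big(d_{\mathbf{w}+\langle v,y\rangle}(p)-d_{\mathbf{w}}(p)\big)$. Threshold Expansion algorithm: Start with $\mathbf{s}=\mathbf{0}$, $M=M_0$ a large number, and $v$ the first node of $V$ in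 a fixed order. While $\mathcal{P}$ is not empty: (i) let $\hat{x}=\max\{y\ge0 : r_{\mathcal{P},\mathbf{x}+\mathbf{s},v}(y)/y\ge M\}$ (with $\hat x=0$ if no $y>0$ satisfies the inequality); (ii) set $\mathbf{s}\leftarrow\mathbf{s}+\langle v,\hat{x}\rangle$; (iii) remove from $\mathcal{P}$ all paths $p$ with $d_{\mathbf{x}+\mathbf{s}}(p)\ge T(1-\varepsilon)$; (iv) if $v$ is the last node, set $M\leftarrow(1-\epsilon)M$ and let $v$ be the first node again; otherwise let $v$ be the next node. Return $\mathbf{s}$. In the bound, $|\mathcal{P}|$ is the size of the input path set. -}

module Defs where

open import Level using (0ℓ)
open import Data.Nat.Base as ℕ using (ℕ; zero; suc)
import Data.Nat.Properties as ℕ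
open import Data.Integer.Base using (+_)
open import Data.Rational.Base as ℚ using (ℚ; 0ℚ; 1ℚ)
import Data.Rational.Properties as ℚ
open import Data.Rational.Solver using (module +-*-Solver)
open import Data.Fin.Base using (Fin)
open import Data.Fin.Properties using (_≟_)
open import Data.List.Base using (List; []; _∷_; foldr; head; last; allFin)
open import Data.List.Membership.Propositional using (_∈_)
open import Data.List.Relation.Unary.All using (All)
open import Data.List.Relation.Unary.Linked using (Linked)
open import Data.List.Relation.Unary.Unique.Propositional using (Unique)
open import Data.List.Relation.Ternary.Interleaving.Propositional using (Interleaving)
open import Data.Maybe.Base using (just)
open import Data.Product.Base using (_×_; _,_; ∃-syntax; proj₁; proj₂)
open import Data.Sum.Base using (inj₁; inj₂)
open import Relation.Binary.Core using (Rel)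
open import Relation.Nullary.Decidable.Core using (yes; no)
open import Relation.Nullary.Negation.Core using (¬_; contradiction)
open import Relation.Binary.PropositionalEquality
  using (_≡_; _≢_; refl; sym; trans; cong; cong₂; subst)

private
  infix 4 _≈[_]_

  _≈[_]_ : ℚ → ℚ → ℚ → Set
  a ≈[ e ] b = ℚ.∣ a ℚ.- b ∣ ℚ.≤ e

  q+[p-q] : ∀ p q → q ℚ.+ (p ℚ.- q) ≡ p
  q+[p-q] = solve 2 (λ p q → q :+ (p :- q) := p) refl
    where open +-*-Solver

  p≤∣p∣ : ∀ p → p ℚ.≤ ℚ.∣ p ∣
  p≤∣p∣ p with ℚ.≤-total 0ℚ p
  ... | inj₁ 0≤p = ℚ.≤-reflexive (sym (ℚ.0≤p⇒∣p∣≡p 0≤p))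
  ... | inj₂ p≤0 = ℚ.≤-trans p≤0 (ℚ.0≤∣p∣ p)

  ∣p-q∣-comm : ∀ p q → ℚ.∣ p ℚ.- q ∣ ≡ ℚ.∣ q ℚ.- p ∣
  ∣p-q∣-comm p q = trans (sym (ℚ.∣-p∣≡∣p∣ (p ℚ.- q))) (cong ℚ.∣_∣ (lemma p q))
    where
    open +-*-Solver
    lemma : ∀ p q → ℚ.- (p ℚ.- q) ≡ q ℚ.- p
    lemma = solve 2 (λ p q → :- (p :- q) := q :- p) refl

  ≈⇒≤ : ∀ {a b e} → a ≈[ e ] b → a ℚ.≤ b ℚ.+ e
  ≈⇒≤ {a} {b} a≈b = subst (ℚ._≤ _) (q+[p-q] a b)
    (ℚ.+-monoʳ-≤ b (ℚ.≤-trans (p≤∣p∣ (a ℚ.- b)) a≈b))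

  ≤⇒- : ∀ {a b e} → a ℚ.≤ b ℚ.+ e → a ℚ.- b ℚ.≤ e
  ≤⇒- {a} {b} {e} h = subst (a ℚ.- b ℚ.≤_) (lemma b e) (ℚ.+-monoˡ-≤ (ℚ.- b) h)
    where
    open +-*-Solver
    lemma : ∀ b e → (b ℚ.+ e) ℚ.- b ≡ e
    lemma = solve 2 (λ b e → (b :+ e) :- b := e) refl

  ≤⇒≈ : ∀ {a b e} → a ℚ.≤ b ℚ.+ e → b ℚ.≤ a ℚ.+ e → a ≈[ e ] b
  ≤⇒≈ {a} {b} a≤ b≤ with ℚ.∣p∣≡p∨∣p∣≡-p (a ℚ.- b)
  ... | inj₁ eq = subst (ℚ._≤ _) (sym eq) (≤⇒- a≤)
  ... | inj₂ eq = subst (ℚ._≤ _)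
    (sym (trans eq (lemma a b))) (≤⇒- b≤)
    where
    open +-*-Solver
    lemma : ∀ a b → ℚ.- (a ℚ.- b) ≡ b ℚ.- a
    lemma = solve 2 (λ a b → :- (a :- b) := b :- a) refl

  ≈-sym : ∀ {a b e} → a ≈[ e ] b → b ≈[ e ] a
  ≈-sym {a} {b} = subst (ℚ._≤ _) (∣p-q∣-comm a b)

  *-mono-≤-nonNeg : ∀ {a b c d} → 0ℚ ℚ.≤ a → 0ℚ ℚ.≤ d →
                    a ℚ.≤ b → c ℚ.≤ d → a ℚ.* c ℚ.≤ b ℚ.* d
  *-mono-≤-nonNeg {a} {b} {c} {d} 0≤a 0≤d a≤b c≤d = ℚ.≤-trans
    (ℚ.*-monoˡ-≤-nonNeg a {{ℚ.nonNegative 0≤a}} c≤d)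
    (ℚ.*-monoʳ-≤-nonNeg d {{ℚ.nonNegative 0≤d}} a≤b)

  0<*0< : ∀ {a b} → 0ℚ ℚ.< a → 0ℚ ℚ.< b → 0ℚ ℚ.< a ℚ.* b
  0<*0< {a} {b} 0<a 0<b = ℚ.positive⁻¹ (a ℚ.* b)
    {{ℚ.pos*pos⇒pos a {{ℚ.positive 0<a}} b {{ℚ.positive 0<b}}}}

recip : ℚ → ℚ
recip p with p ℚ.≟ 0ℚ
... | yes _  = 0ℚ
... | no p≢0 = (ℚ.1/ p) {{ℚ.≢-nonZero p≢0}}

*-recip : ∀ {p} → 0ℚ ℚ.< p → p ℚ.* recip p ≡ 1ℚ
*-recip {p} 0<p with p ℚ.≟ 0ℚ
... | yes p≡0 = contradiction (sym p≡0) (ℚ.<⇒≢ 0<p)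
... | no p≢0  = ℚ.*-inverseʳ p {{ℚ.≢-nonZero p≢0}}

0<recip : ∀ {p} → 0ℚ ℚ.< p → 0ℚ ℚ.< recip p
0<recip {p} 0<p with p ℚ.≟ 0ℚ
... | yes p≡0 = contradiction (sym p≡0) (ℚ.<⇒≢ 0<p)
... | no p≢0  = ℚ.positive⁻¹ _ {{ℚ.1/pos⇒pos p {{ℚ.positive 0<p}}}}

private
  half : ∀ {e} → 0ℚ ℚ.< e → ∃[ d ] 0ℚ ℚ.< d × d ℚ.+ d ≡ e
  half {e} 0<e = e ℚ.* ℚ.½ , 0<*0< 0<e (ℚ.positive⁻¹ ℚ.½) ,
    trans (sym (ℚ.*-distribˡ-+ e ℚ.½ ℚ.½)) (ℚ.*-identityʳ e)

  scale : ∀ {k e} → 0ℚ ℚ.< k → 0ℚ ℚ.< e → ∃[ d ] 0ℚ ℚ.< d × k ℚ.* d ≡ e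
  scale {k} {e} 0<k 0<e = recip k ℚ.* e , 0<*0< (0<recip 0<k) 0<e ,
    trans (sym (ℚ.*-assoc k (recip k) e))
      (trans (cong (ℚ._* e) (*-recip 0<k)) (ℚ.*-identityˡ e))

  0<+0< : ∀ {a b} → 0ℚ ℚ.< a → 0ℚ ℚ.< b → 0ℚ ℚ.< a ℚ.+ b
  0<+0< = ℚ.+-mono-<

  ≈-+ : ∀ {a b c d e} → a ≈[ e ] b → c ≈[ e ] d → a ℚ.+ c ≈[ e ℚ.+ e ] b ℚ.+ d
  ≈-+ {a} {b} {c} {d} {e} a≈b c≈d =
    subst (λ z → ℚ.∣ z ∣ ℚ.≤ e ℚ.+ e) (lemma a b c d)
      (ℚ.≤-trans (ℚ.∣p+q∣≤∣p∣+∣q∣ (a ℚ.- b) (c ℚ.- d)) (ℚ.+-mono-≤ a≈b c≈d))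
    where
    open +-*-Solver
    lemma : ∀ a b c d → (a ℚ.- b) ℚ.+ (c ℚ.- d) ≡ (a ℚ.+ c) ℚ.- (b ℚ.+ d)
    lemma = solve 4 (λ a b c d → (a :- b) :+ (c :- d) := (a :+ c) :- (b :+ d)) refl

  ≈-neg : ∀ {a b e} → a ≈[ e ] b → ℚ.- a ≈[ e ] ℚ.- b
  ≈-neg {a} {b} {e} a≈b = subst (λ z → ℚ.∣ z ∣ ℚ.≤ e) (lemma a b) (≈-sym {a} {b} a≈b)
    where
    open +-*-Solver
    lemma : ∀ a b → b ℚ.- a ≡ (ℚ.- a) ℚ.- (ℚ.- b)
    lemma = solve 2 (λ a b → b :- a := (:- a) :- (:- b)) refl

  ⊓-+-distrib : ∀ a b e → (a ℚ.⊓ b) ℚ.+ e ≡ (a ℚ.+ e) ℚ.⊓ (b ℚ.+ e)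
  ⊓-+-distrib a b e = ℚ.mono-≤-distrib-⊓ (ℚ.+-monoˡ-≤ e) a b

  ⊓-shift : ∀ {a b c d e} → a ℚ.≤ b ℚ.+ e → c ℚ.≤ d ℚ.+ e → a ℚ.⊓ c ℚ.≤ (b ℚ.⊓ d) ℚ.+ e
  ⊓-shift {a} {b} {c} {d} {e} h k =
    subst (a ℚ.⊓ c ℚ.≤_) (sym (⊓-+-distrib b d e)) (ℚ.⊓-mono-≤ h k)

  ≈-⊓ : ∀ {a b c d e} → a ≈[ e ] b → c ≈[ e ] d → a ℚ.⊓ c ≈[ e ] b ℚ.⊓ d
  ≈-⊓ {a} {b} {c} {d} a≈b c≈d = ≤⇒≈
    (⊓-shift {a} {b} {c} {d} (≈⇒≤ {a} {b} a≈b) (≈⇒≤ {c} {d} c≈d))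
    (⊓-shift {b} {a} {d} {c} (≈⇒≤ {b} {a} (≈-sym {a} {b} a≈b)) (≈⇒≤ {d} {c} (≈-sym {c} {d} c≈d)))

  ≈-* : ∀ {a b c d e A C} → 0ℚ ℚ.≤ e → ℚ.∣ a ∣ ℚ.≤ A → ℚ.∣ d ∣ ℚ.≤ C →
        a ≈[ e ] b → c ≈[ e ] d → a ℚ.* c ≈[ (A ℚ.+ C) ℚ.* e ] b ℚ.* d
  ≈-* {a} {b} {c} {d} {e} {A} {C} 0≤e a≤A d≤C a≈b c≈d =
    subst (λ z → ℚ.∣ z ∣ ℚ.≤ (A ℚ.+ C) ℚ.* e) (lemma a b c d)
      (ℚ.≤-trans (ℚ.∣p+q∣≤∣p∣+∣q∣ (a ℚ.* (c ℚ.- d)) (d ℚ.* (a ℚ.- b)))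
      (ℚ.≤-trans (ℚ.+-mono-≤ (bound a≤A c≈d) (bound d≤C a≈b))
        (ℚ.≤-reflexive (sym (ℚ.*-distribʳ-+ e A C)))))
    where
    open +-*-Solver
    lemma : ∀ a b c d →
            (a ℚ.* (c ℚ.- d)) ℚ.+ (d ℚ.* (a ℚ.- b)) ≡ (a ℚ.* c) ℚ.- (b ℚ.* d)
    lemma = solve 4
      (λ a b c d → (a :* (c :- d)) :+ (d :* (a :- b)) := (a :* c) :- (b :* d)) refl
    bound : ∀ {p q P} → ℚ.∣ p ∣ ℚ.≤ P → ℚ.∣ q ∣ ℚ.≤ e → ℚ.∣ p ℚ.* q ∣ ℚ.≤ P ℚ.* e
    bound {p} {q} p≤ q≤ = subst (ℚ._≤ _) (sym (ℚ.∣p*q∣≡∣p∣*∣q∣ p q))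
      (*-mono-≤-nonNeg (ℚ.0≤∣p∣ p) 0≤e p≤ q≤)

  ≈-recip : ∀ {a b d e} → 0ℚ ℚ.< d → 0ℚ ℚ.< e → d ℚ.≤ a → d ℚ.≤ b →
            a ≈[ e ℚ.* (d ℚ.* d) ] b → recip a ≈[ e ] recip b
  ≈-recip {a} {b} {d} {e} 0<d 0<e d≤a d≤b a≈b =
    ℚ.*-cancelʳ-≤-pos (a ℚ.* b) {{ℚ.positive 0<ab}}
      (ℚ.≤-trans (ℚ.≤-reflexive scaled)
      (ℚ.≤-trans a≈b (ℚ.*-monoˡ-≤-nonNeg e {{ℚ.nonNegative (ℚ.<⇒≤ 0<e)}} dd≤ab)))
    where
    0<a = ℚ.<-≤-trans 0<d d≤a
    0<b = ℚ.<-≤-trans 0<d d≤b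
    0<ab = 0<*0< 0<a 0<b
    dd≤ab : d ℚ.* d ℚ.≤ a ℚ.* b
    dd≤ab = *-mono-≤-nonNeg (ℚ.<⇒≤ 0<d) (ℚ.<⇒≤ 0<b) d≤a d≤b
    expand : ∀ a b u v → (u ℚ.- v) ℚ.* (a ℚ.* b) ≡ b ℚ.* (a ℚ.* u) ℚ.- a ℚ.* (b ℚ.* v)
    expand = solve 4
      (λ a b u v → (u :- v) :* (a :* b) := b :* (a :* u) :- a :* (b :* v)) refl
      where open +-*-Solver
    cleared : (recip a ℚ.- recip b) ℚ.* (a ℚ.* b) ≡ b ℚ.- a
    cleared = trans (expand a b (recip a) (recip b)) (cong₂ ℚ._-_
      (trans (cong (b ℚ.*_) (*-recip 0<a)) (ℚ.*-identityʳ b))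
      (trans (cong (a ℚ.*_) (*-recip 0<b)) (ℚ.*-identityʳ a)))
    scaled : ℚ.∣ recip a ℚ.- recip b ∣ ℚ.* (a ℚ.* b) ≡ ℚ.∣ a ℚ.- b ∣
    scaled = trans (cong (ℚ.∣ recip a ℚ.- recip b ∣ ℚ.*_) (sym (ℚ.0≤p⇒∣p∣≡p (ℚ.<⇒≤ 0<ab))))
      (trans (sym (ℚ.∣p*q∣≡∣p∣*∣q∣ (recip a ℚ.- recip b) (a ℚ.* b)))
      (trans (cong ℚ.∣_∣ cleared) (∣p-q∣-comm b a)))

-- The real numbers are Cauchy sequences of rationals, with _≃_ as equality.

Cauchy : (ℕ → ℚ) → Set
Cauchy x = ∀ ε → 0ℚ ℚ.< ε →
  ∃[ N ] ∀ m n → N ℕ.≤ m → N ℕ.≤ n → ℚ.∣ x m ℚ.- x n ∣ ℚ.≤ ε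

record ℝ : Set where
  constructor mkℝ
  field
    seq    : ℕ → ℚ
    cauchy : Cauchy seq
open ℝ public

infix  4 _≤_ _<_ _≃_
infixl 6 _+_ _-_
infixl 7 _*_ _÷_by_ _⊓_
infix  8 -_
infixr 8 _^_

record _≤_ (x y : ℝ) : Set where
  constructor mk≤
  field
    eventually : ∀ ε → 0ℚ ℚ.< ε → ∃[ N ] ∀ n → N ℕ.≤ n → seq x n ℚ.≤ seq y n ℚ.+ ε

record _<_ (x y : ℝ) : Set where
  constructor mk<
  field
    gap        : ℚ
    0<gap      : 0ℚ ℚ.< gap
    from       : ℕ
    eventually : ∀ n → from ℕ.≤ n → seq x n ℚ.+ gap ℚ.≤ seq y n

_≃_ : ℝ → ℝ → Set
x ≃ y = x ≤ y × y ≤ x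

private
  ∃bound : ∀ x → ∃[ B ] 0ℚ ℚ.< B × ∃[ N ] ∀ n → N ℕ.≤ n → ℚ.∣ seq x n ∣ ℚ.≤ B
  ∃bound x with cauchy x 1ℚ (ℚ.positive⁻¹ 1ℚ)
  ... | N , c = ℚ.∣ seq x N ∣ ℚ.+ 1ℚ ,
    ℚ.+-mono-≤-< (ℚ.0≤∣p∣ (seq x N)) (ℚ.positive⁻¹ 1ℚ) , N , λ n N≤n →
      ℚ.≤-trans (ℚ.≤-reflexive (cong ℚ.∣_∣ (sym (q+[p-q] (seq x n) (seq x N)))))
      (ℚ.≤-trans (ℚ.∣p+q∣≤∣p∣+∣q∣ (seq x N) (seq x n ℚ.- seq x N))
        (ℚ.+-monoʳ-≤ ℚ.∣ seq x N ∣ (c n N N≤n ℕ.≤-refl)))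

private abstract
  const-cauchy : ∀ q → Cauchy (λ _ → q)
  const-cauchy q ε 0<ε = 0 , λ _ _ _ _ →
    subst (ℚ._≤ ε) (cong ℚ.∣_∣ (sym (ℚ.+-inverseʳ q))) (ℚ.<⇒≤ 0<ε)

fromℚ : ℚ → ℝ
fromℚ q = mkℝ (λ _ → q) (const-cauchy q)

fromℕ : ℕ → ℝ
fromℕ n = fromℚ (+ n ℚ./ 1)

0ℝ 1ℝ : ℝ
0ℝ = fromℚ 0ℚ
1ℝ = fromℚ 1ℚ

private abstract
  +-cauchy : ∀ x y → Cauchy (λ n → seq x n ℚ.+ seq y n)
  +-cauchy x y ε 0<ε with half 0<ε
  ... | δ , 0<δ , refl with cauchy x δ 0<δ | cauchy y δ 0<δ
  ... | N , c | N′ , c′ = N ℕ.⊔ N′ , λ m n ≤m ≤n →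
    ≈-+ {seq x m} {seq x n} {seq y m} {seq y n}
      (c  m n (ℕ.m⊔n≤o⇒m≤o N N′ ≤m) (ℕ.m⊔n≤o⇒m≤o N N′ ≤n))
      (c′ m n (ℕ.m⊔n≤o⇒n≤o N N′ ≤m) (ℕ.m⊔n≤o⇒n≤o N N′ ≤n))

  neg-cauchy : ∀ x → Cauchy (λ n → ℚ.- seq x n)
  neg-cauchy x ε 0<ε with cauchy x ε 0<ε
  ... | N , c = N , λ m n ≤m ≤n → ≈-neg {seq x m} {seq x n} (c m n ≤m ≤n)

  ⊓-cauchy : ∀ x y → Cauchy (λ n → seq x n ℚ.⊓ seq y n)
  ⊓-cauchy x y ε 0<ε with cauchy x ε 0<ε | cauchy y ε 0<ε
  ... | N , c | N′ , c′ = N ℕ.⊔ N′ , λ m n ≤m ≤n →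
    ≈-⊓ {seq x m} {seq x n} {seq y m} {seq y n}
      (c  m n (ℕ.m⊔n≤o⇒m≤o N N′ ≤m) (ℕ.m⊔n≤o⇒m≤o N N′ ≤n))
      (c′ m n (ℕ.m⊔n≤o⇒n≤o N N′ ≤m) (ℕ.m⊔n≤o⇒n≤o N N′ ≤n))

  *-cauchy : ∀ x y → Cauchy (λ n → seq x n ℚ.* seq y n)
  *-cauchy x y ε 0<ε =
    let A , 0<A , M  , x≤A = ∃bound x
        C , 0<C , M′ , y≤C = ∃bound y
        δ , 0<δ , total    = scale {A ℚ.+ C} (0<+0< {A} 0<A 0<C) 0<ε
        N  , c             = cauchy x δ 0<δ
        N′ , c′            = cauchy y δ 0<δ
    in (M ℕ.⊔ M′) ℕ.⊔ (N ℕ.⊔ N′) , λ m n ≤m ≤n →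
      let ml = ℕ.m⊔n≤o⇒m≤o (M ℕ.⊔ M′) (N ℕ.⊔ N′) ≤m
          nl = ℕ.m⊔n≤o⇒m≤o (M ℕ.⊔ M′) (N ℕ.⊔ N′) ≤n
          mr = ℕ.m⊔n≤o⇒n≤o (M ℕ.⊔ M′) (N ℕ.⊔ N′) ≤m
          nr = ℕ.m⊔n≤o⇒n≤o (M ℕ.⊔ M′) (N ℕ.⊔ N′) ≤n
      in ℚ.≤-trans
        (≈-* {seq x m} {seq x n} {seq y m} {seq y n} {δ} {A} {C} (ℚ.<⇒≤ 0<δ)
          (x≤A m (ℕ.m⊔n≤o⇒m≤o M M′ ml)) (y≤C n (ℕ.m⊔n≤o⇒n≤o M M′ nl))
          (c  m n (ℕ.m⊔n≤o⇒m≤o N N′ mr) (ℕ.m⊔n≤o⇒m≤o N N′ nr))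
          (c′ m n (ℕ.m⊔n≤o⇒n≤o N N′ mr) (ℕ.m⊔n≤o⇒n≤o N N′ nr)))
        (ℚ.≤-reflexive total)

  recip-cauchy : ∀ x → 0ℝ < x → Cauchy (λ n → recip (seq x n))
  recip-cauchy x (mk< d 0<d M d≤x) ε 0<ε =
    let N , c = cauchy x (ε ℚ.* (d ℚ.* d)) (0<*0< 0<ε (0<*0< 0<d 0<d))
    in M ℕ.⊔ N , λ m n ≤m ≤n → ≈-recip 0<d 0<ε
      (lower m (ℕ.m⊔n≤o⇒m≤o M N ≤m)) (lower n (ℕ.m⊔n≤o⇒m≤o M N ≤n))
      (c m n (ℕ.m⊔n≤o⇒n≤o M N ≤m) (ℕ.m⊔n≤o⇒n≤o M N ≤n))
    where
    lower : ∀ n → M ℕ.≤ n → d ℚ.≤ seq x n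
    lower n M≤n = subst (ℚ._≤ seq x n) (ℚ.+-identityˡ d) (d≤x n M≤n)

_+_ _*_ _⊓_ : ℝ → ℝ → ℝ
x + y = mkℝ (λ n → seq x n ℚ.+ seq y n) (+-cauchy x y)
x * y = mkℝ (λ n → seq x n ℚ.* seq y n) (*-cauchy x y)
x ⊓ y = mkℝ (λ n → seq x n ℚ.⊓ seq y n) (⊓-cauchy x y)

-_ : ℝ → ℝ
- x = mkℝ (λ n → ℚ.- seq x n) (neg-cauchy x)

_-_ : ℝ → ℝ → ℝ
x - y = x + (- y)

-- The terms of a positive x are eventually bounded away from 0, so the value 0
-- that recip takes at 0 does not affect the limit.
inv : (x : ℝ) → 0ℝ < x → ℝ
inv x 0<x = mkℝ (λ n → recip (seq x n)) (recip-cauchy x 0<x)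

_÷_by_ : ℝ → (y : ℝ) → 0ℝ < y → ℝ
x ÷ y by 0<y = x * inv y 0<y

_^_ : ℝ → ℕ → ℝ
x ^ zero  = 1ℝ
x ^ suc n = x * x ^ n

abstract
  x<y⇒0<y-x : ∀ {x y} → x < y → 0ℝ < y - x
  x<y⇒0<y-x {x} {y} (mk< d 0<d N x+d≤y) = mk< d 0<d N λ n N≤n →
    subst (ℚ._≤ seq y n ℚ.- seq x n) (lemma (seq x n) d)
      (ℚ.+-monoˡ-≤ (ℚ.- seq x n) (x+d≤y n N≤n))
    where
    open +-*-Solver
    lemma : ∀ a d → (a ℚ.+ d) ℚ.- a ≡ 0ℚ ℚ.+ d
    lemma = solve 2 (λ a d → (a :+ d) :- a := con 0ℚ :+ d) refl

Converges : (ℕ → ℝ) → ℝ → Set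
Converges u l = ∀ δ → 0ℝ < δ →
  ∃[ N ] ∀ n → N ℕ.≤ n → l - δ < u n × u n < l + δ

-- exp x = lim (1 + x/n)ⁿ, shifted to avoid n = 0; as existence of the limit is
-- not proved here, exp and its inverse ln are given by their graphs.
IsExp : ℝ → ℝ → Set
IsExp x z = Converges (λ n → (1ℝ + x * fromℚ (+ 1 ℚ./ suc n)) ^ suc n) z

IsLn : ℝ → ℝ → Set
IsLn z l = IsExp l z

sum : ∀ {A : Set} → (A → ℝ) → List A → ℝ
sum g = foldr (λ a t → g a + t) 0ℝ

record ℝ≥0 : Set where
  constructor mkℝ≥0
  field
    val    : ℝ
    nonNeg : 0ℝ ≤ val
open ℝ≥0 public

private abstract
  0≤0 : 0ℝ ≤ 0ℝ
  0≤0 = mk≤ λ ε 0<ε → 0 , λ _ _ → ℚ.+-mono-≤ ℚ.≤-refl (ℚ.<⇒≤ 0<ε)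

  0≤+ : ∀ {a b} → 0ℝ ≤ a → 0ℝ ≤ b → 0ℝ ≤ a + b
  0≤+ {a} {b} 0≤a 0≤b = mk≤ λ ε 0<ε → body ε (half 0<ε)
    where
    body : ∀ ε → (∃[ δ ] 0ℚ ℚ.< δ × δ ℚ.+ δ ≡ ε) →
           ∃[ N ] ∀ n → N ℕ.≤ n → 0ℚ ℚ.≤ seq (a + b) n ℚ.+ ε
    body _ (δ , 0<δ , refl)
      with _≤_.eventually 0≤a δ 0<δ | _≤_.eventually 0≤b δ 0<δ
    ... | N , p | N′ , q = N ℕ.⊔ N′ , λ n ≤n →
      subst (0ℚ ℚ.≤_) (lemma (seq a n) (seq b n) δ)
        (ℚ.+-mono-≤ (p n (ℕ.m⊔n≤o⇒m≤o N N′ ≤n)) (q n (ℕ.m⊔n≤o⇒n≤o N N′ ≤n)))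
      where
      open +-*-Solver
      lemma : ∀ a b δ → (a ℚ.+ δ) ℚ.+ (b ℚ.+ δ) ≡ (a ℚ.+ b) ℚ.+ (δ ℚ.+ δ)
      lemma = solve 3 (λ a b δ → (a :+ δ) :+ (b :+ δ) := (a :+ b) :+ (δ :+ δ)) refl

0≥0 : ℝ≥0
0≥0 = mkℝ≥0 0ℝ 0≤0

_+≥0_ : ℝ≥0 → ℝ≥0 → ℝ≥0
a +≥0 b = mkℝ≥0 (val a + val b) (0≤+ (nonNeg a) (nonNeg b))

record Network : Set₁ where
  field
    n      : ℕ
    Edge   : Rel (Fin n) 0ℓ
    Target : Rel (Fin n) 0ℓ
    f      : Fin n → ℝ≥0 → ℝ≥0
    -- Monotonicity with respect to _≤_ also makes each f v respect _≃_.
    f-mono : ∀ v {a b} → val a ≤ val b → val (f v a) ≤ val (f v b)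
    T      : ℝ

module ThresholdBlocking (𝒩 : Network) where
  open Network 𝒩 public

  V : Set
  V = Fin n

  Impact : Set
  Impact = V → ℝ≥0

  ‖_‖ : Impact → ℝ
  ‖ x ‖ = sum (λ v → val (x v)) (allFin n)

  infix  4 _≤ᵛ_
  infixl 6 _⊕_

  _≤ᵛ_ : Impact → Impact → Set
  x ≤ᵛ y = ∀ v → val (x v) ≤ val (y v)

  _⊕_ : Impact → Impact → Impact
  (x ⊕ y) v = x v +≥0 y v

  𝟎 : Impact
  𝟎 _ = 0≥0

  ⟨_,_⟩ : V → ℝ≥0 → Impact
  ⟨ v , y ⟩ u with u ≟ v
  ... | yes _ = y
  ... | no _  = 0≥0

  Path : Set
  Path = List V

  weight : Impact → Path → ℝ
  weight x = sum (λ v → val (f v (x v)))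

  d : Impact → Path → ℝ
  d x p = weight x p ⊓ T

  record Feasible (p : Path) : Set where
    field
      {source target} : V
      linked     : Linked Edge p
      simple     : Unique p
      starts     : head p ≡ just source
      ends       : last p ≡ just target
      connects   : Target source target
      weight<T   : weight 𝟎 p < T

  r : List Path → Impact → V → ℝ≥0 → ℝ
  r P w v y = sum (λ p → d (w ⊕ ⟨ v , y ⟩) p - d w p) P

  record Input : Set where
    field
      𝒫         : List Path
      distinct  : Unique 𝒫
      feasible  : All Feasible 𝒫
      x         : Impact
      unblocked : All (λ p → d x p < T) 𝒫
      ε         : ℝ
      0<ε       : 0ℝ < ε
      ε<1       : ε < 1ℝ

  module _ (I : Input) where
    open Input I

    Blocks : Impact → Set
    Blocks s = ∀ {p} → p ∈ 𝒫 → T ≤ d (x ⊕ s) p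

    Optimal : Impact → Set
    Optimal s = Blocks s × (∀ s′ → Blocks s′ → ‖ s ‖ ≤ ‖ s′ ‖)

  -- IsStep P w M v ŷ: ŷ is the maximum of { y | r P w v y / y ≥ M }, taken over
  -- y > 0 since the quotient is undefined at 0; ŷ is 0 if there is no such y.
  data IsStep (P : List Path) (w : Impact) (M : ℝ) (v : V) (ŷ : ℝ≥0) : Set where
    maximum : (0<ŷ : 0ℝ < val ŷ) →
              M ≤ r P w v ŷ ÷ val ŷ by 0<ŷ →
              (∀ y (0<y : 0ℝ < val y) → M ≤ r P w v y ÷ val y by 0<y → val y ≤ val ŷ) →
              IsStep P w M v ŷ
    none    : (∀ y (0<y : 0ℝ < val y) → ¬ (M ≤ r P w v y ÷ val y by 0<y)) →
              val ŷ ≃ 0ℝ →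
              IsStep P w M v ŷ

  -- η is the parameter by which M decays (ϵ in the usual notation, distinct
  -- from the accuracy ε); order is the fixed order in which V is traversed.
  module _ (I : Input) (order : List V) (η : ℝ) where
    open Input I

    advance : ℝ → List V → ℝ × List V
    advance M []       = (1ℝ - η) * M , order
    advance M (v ∷ vs) = M , v ∷ vs

    AlmostBlocked : Impact → Path → Set
    AlmostBlocked s p = T * (1ℝ - ε) ≤ d (x ⊕ s) p

    -- Run P s M vs out: from remaining paths P, current vector s and threshold M,
    -- with the nodes vs still to be treated in this pass, the loop returns out.
    -- The loop is a relation because the order on ℝ is not decidable and the
    -- maximum in a step need not exist.
    data Run : List Path → Impact → ℝ → List V → Impact → Set where
      done : ∀ {s M vs} → Run [] s M vs s
      step : ∀ {P removed P′ s M v vs ŷ out} →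
             P ≢ [] →
             IsStep P (x ⊕ s) M v ŷ →
             let s′ = s ⊕ ⟨ v , ŷ ⟩ in
             Interleaving removed P′ P →
             All (AlmostBlocked s′) removed →
             All (λ p → ¬ AlmostBlocked s′ p) P′ →
             Run P′ s′ (proj₁ (advance M vs)) (proj₂ (advance M vs)) out →
             Run P s M (v ∷ vs) out

    ThresholdExpansion : ℝ → Impact → Set
    ThresholdExpansion M₀ s = Run 𝒫 𝟎 M₀ order s

{-# OPTIONS --safe #-}
-- Because truncation at T is concave, Σ d p is submodular in the impact vector;
-- the deficit of the remaining paths is Σ (T - d p). Hence at threshold M every node v
-- has marginal gain at most M y / (1 - η) for every increment y, and adding s*
-- node by node gives deficit ≤ M ‖s*‖ / (1 - η). A step of size ŷ gains at least
-- M ŷ, so (1 - η) ŷ ≤ a ‖s*‖, where a ≤ 1 is the relative decrease of the deficit.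
-- Let A be the sum of a over all steps but the last. The deficit starts below
-- |𝒫| T and, as long as a path remains, stays above T ε, so the factors 1 - a
-- multiply to at least ε / |𝒫|. Since (1 + (A + a)/m)ᵐ (1 - a) ≤ (1 + A/m)ᵐ by the
-- tangent inequality for powers, (1 + A/m)ᵐ ≤ |𝒫| / ε for all m, so A ≤ L.

module Submission where

open import Defs
open import Level using (0ℓ)
open import Data.Fin.Properties using (_≟_)
open import Data.Integer.Base as ℤ using (+_)
import Data.Integer.Properties as ℤ
open import Data.List.Base using (List; []; _∷_; length; allFin)
open import Data.List.Membership.Propositional using (_∈_; _∉_)
open import Data.List.Membership.Propositional.Properties using (∈-allFin)
open import Data.List.Relation.Binary.Permutation.Propositional using (_↭_; ↭-sym)
open import Data.List.Relation.Binary.Permutation.Propositional.Properties using (∈-resp-↭)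
open import Data.List.Relation.Ternary.Interleaving.Propositional
  using (Interleaving; []; consˡ; consʳ)
open import Data.List.Relation.Unary.All as All using (All; []; _∷_)
open import Data.List.Relation.Unary.Any using (here; there)
open import Data.List.Relation.Unary.Unique.Propositional using (Unique; []; _∷_)
open import Data.List.Relation.Unary.Unique.Propositional.Properties using (allFin⁺)
open import Data.Nat.Base as ℕ using (ℕ; zero; suc)
import Data.Nat.Properties as ℕ
open import Data.Nat.Coprimality using (1-coprimeTo) renaming (sym to coprime-sym)
open import Data.Product.Base using (_×_; _,_; ∃-syntax; proj₁; proj₂; swap)
open import Data.Rational.Base as ℚ using (ℚ; 0ℚ; 1ℚ; ½; mkℚ; *≤*)
import Data.Rational.Properties as ℚ
open import Data.Rational.Solver using (module +-*-Solver)
open import Data.Sum.Base using (_⊎_; inj₁; inj₂)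
open import Relation.Binary.Bundles using (Poset)
open import Relation.Binary.PropositionalEquality
  using (_≡_; _≢_; refl; sym; trans; cong; cong₂; subst; subst₂)
open import Relation.Nullary.Decidable.Core using (yes; no)
open import Relation.Nullary.Negation.Core using (¬_; contradiction)

open +-*-Solver using (solve; con; _:+_; _:*_; _:-_; :-_; _:=_)

-- The ordered field of Cauchy reals

-- The functions `f v` are only monotone, so the gain at a node need not be concave in the increment
-- at that same node: diminishing returns hold only with respect to the other nodes. This is why a
-- step takes the largest `ŷ` that meets the threshold: every larger total increment falls short of
-- it, so whatever can still be gained at that node is again worth at most `M` per unit. The last
-- step stays out of `A` because it may bring the deficit to 0, where `1 - a` has no positive lower
-- bound; its own `a ≤ 1` is the summand 1 of the bound. The order on `ℝ` cannot be decided, so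
-- comparisons are obtained by refuting the opposite one. The logarithm is given only by its graph,
-- so the product of the factors `1 - a` is compared with compound-interest terms, and `L` enters
-- through their convergence alone.

Eventually : (ℕ → Set) → Set
Eventually P = ∃[ N ] ∀ n → N ℕ.≤ n → P n

map₂ : ∀ {P Q R : ℕ → Set} → (∀ n → P n → Q n → R n) →
       Eventually P → Eventually Q → Eventually R
map₂ h (M , p) (N , q) = M ℕ.⊔ N , λ n ≤n →
  h n (p n (ℕ.m⊔n≤o⇒m≤o M N ≤n)) (q n (ℕ.m⊔n≤o⇒n≤o M N ≤n))

*-pos : ∀ {p q} → 0ℚ ℚ.< p → 0ℚ ℚ.< q → 0ℚ ℚ.< p ℚ.* q
*-pos {p} {q} 0<p 0<q = ℚ.positive⁻¹ (p ℚ.* q)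
  {{ℚ.pos*pos⇒pos p {{ℚ.positive 0<p}} q {{ℚ.positive 0<q}}}}

½*-pos : ∀ {e} → 0ℚ ℚ.< e → 0ℚ ℚ.< ½ ℚ.* e
½*-pos = *-pos (ℚ.positive⁻¹ ½)

≤⇒0≤- : ∀ {p q} → p ℚ.≤ q → 0ℚ ℚ.≤ q ℚ.- p
≤⇒0≤- {p} {q} p≤q = subst (ℚ._≤ q ℚ.- p) (ℚ.+-inverseʳ p) (ℚ.+-monoˡ-≤ (ℚ.- p) p≤q)

0≤-⇒≤ : ∀ {p q} → 0ℚ ℚ.≤ q ℚ.- p → p ℚ.≤ q
0≤-⇒≤ {p} {q} h = subst₂ ℚ._≤_ (ℚ.+-identityˡ p)
  (solve 2 (λ p q → (q :- p) :+ p := q) refl p q) (ℚ.+-monoˡ-≤ p h)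

*-nonNeg : ∀ {p q} → 0ℚ ℚ.≤ p → 0ℚ ℚ.≤ q → 0ℚ ℚ.≤ p ℚ.* q
*-nonNeg {p} {q} 0≤p 0≤q = subst (ℚ._≤ p ℚ.* q) (ℚ.*-zeroʳ p)
  (ℚ.*-monoˡ-≤-nonNeg p {{ℚ.nonNegative 0≤p}} 0≤q)

eventually⇒≤ : ∀ {x y} → Eventually (λ n → seq x n ℚ.≤ seq y n) → x ≤ y
eventually⇒≤ {x} {y} (N , h) = mk≤ λ ε 0<ε → N , λ n N≤n →
  ℚ.≤-trans (h n N≤n) (ℚ.≤-trans (ℚ.≤-reflexive (sym (ℚ.+-identityʳ _)))
    (ℚ.+-monoʳ-≤ (seq y n) (ℚ.<⇒≤ 0<ε)))

pointwise-≤ : ∀ {x y} → (∀ n → seq x n ℚ.≤ seq y n) → x ≤ y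
pointwise-≤ h = eventually⇒≤ (0 , λ n _ → h n)

pointwise-≃ : ∀ {x y} → (∀ n → seq x n ≡ seq y n) → x ≃ y
pointwise-≃ h = pointwise-≤ (λ n → ℚ.≤-reflexive (h n)) ,
                pointwise-≤ (λ n → ℚ.≤-reflexive (sym (h n)))

≤-refl : ∀ {x} → x ≤ x
≤-refl = pointwise-≤ λ _ → ℚ.≤-refl

≃-refl : ∀ {x} → x ≃ x
≃-refl = ≤-refl , ≤-refl

≃-sym : ∀ {x y} → x ≃ y → y ≃ x
≃-sym = swap

≤-trans : ∀ {x y z} → x ≤ y → y ≤ z → x ≤ z
≤-trans {x} {y} {z} (mk≤ x≤y) (mk≤ y≤z) = mk≤ λ ε 0<ε →
  map₂ (λ n p q → ℚ.≤-trans p (ℚ.≤-trans (ℚ.+-monoˡ-≤ (½ ℚ.* ε) q)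
    (ℚ.≤-reflexive (lemma (seq z n) ε))))
    (x≤y (½ ℚ.* ε) (½*-pos 0<ε)) (y≤z (½ ℚ.* ε) (½*-pos 0<ε))
  where
  lemma : ∀ z e → (z ℚ.+ ½ ℚ.* e) ℚ.+ ½ ℚ.* e ≡ z ℚ.+ e
  lemma = solve 2 (λ z e → (z :+ con ½ :* e) :+ con ½ :* e := z :+ e) refl

≤-poset : Poset 0ℓ 0ℓ 0ℓ
≤-poset = record
  { Carrier = ℝ
  ; _≈_ = _≃_
  ; _≤_ = _≤_
  ; isPartialOrder = record
    { isPreorder = record
      { isEquivalence = record
        { refl  = ≃-refl
        ; sym   = ≃-sym
        ; trans = λ (p , q) (p′ , q′) → ≤-trans p p′ , ≤-trans q′ q
        }
      ; reflexive = proj₁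
      ; trans     = ≤-trans
      }
    ; antisym = _,_
    }
  }

open import Relation.Binary.Reasoning.PartialOrder ≤-poset

+-mono-≤ : ∀ {x x′ y y′} → x ≤ x′ → y ≤ y′ → x + y ≤ x′ + y′
+-mono-≤ {x′ = x′} {y′ = y′} (mk≤ p) (mk≤ q) = mk≤ λ ε 0<ε →
  map₂ (λ n p q → ℚ.≤-trans (ℚ.+-mono-≤ p q)
    (ℚ.≤-reflexive (lemma (seq x′ n) (seq y′ n) ε)))
    (p (½ ℚ.* ε) (½*-pos 0<ε)) (q (½ ℚ.* ε) (½*-pos 0<ε))
  where
  lemma : ∀ a b e → (a ℚ.+ ½ ℚ.* e) ℚ.+ (b ℚ.+ ½ ℚ.* e) ≡ (a ℚ.+ b) ℚ.+ e
  lemma = solve 3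
    (λ a b e → (a :+ con ½ :* e) :+ (b :+ con ½ :* e) := (a :+ b) :+ e) refl

+-monoˡ-≤ : ∀ z {x y} → x ≤ y → x + z ≤ y + z
+-monoˡ-≤ z x≤y = +-mono-≤ x≤y (≤-refl {z})

+-monoʳ-≤ : ∀ z {x y} → x ≤ y → z + x ≤ z + y
+-monoʳ-≤ z x≤y = +-mono-≤ (≤-refl {z}) x≤y

+-cong : ∀ {x x′ y y′} → x ≃ x′ → y ≃ y′ → x + y ≃ x′ + y′
+-cong (p , q) (p′ , q′) = +-mono-≤ p p′ , +-mono-≤ q q′

+-identityʳ : ∀ x → x + 0ℝ ≃ x
+-identityʳ x = pointwise-≃ λ k → ℚ.+-identityʳ (seq x k)

*-identityʳ : ∀ x → x * 1ℝ ≃ x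
*-identityʳ x = pointwise-≃ λ k → ℚ.*-identityʳ (seq x k)

*-identityˡ : ∀ x → 1ℝ * x ≃ x
*-identityˡ x = pointwise-≃ λ k → ℚ.*-identityˡ (seq x k)

+-comm : ∀ x y → x + y ≃ y + x
+-comm x y = pointwise-≃ λ k → ℚ.+-comm (seq x k) (seq y k)

+-assoc : ∀ x y z → (x + y) + z ≃ x + (y + z)
+-assoc x y z = pointwise-≃ λ k → ℚ.+-assoc (seq x k) (seq y k) (seq z k)

*-comm : ∀ x y → x * y ≃ y * x
*-comm x y = pointwise-≃ λ k → ℚ.*-comm (seq x k) (seq y k)

*-assoc : ∀ x y z → (x * y) * z ≃ x * (y * z)
*-assoc x y z = pointwise-≃ λ k → ℚ.*-assoc (seq x k) (seq y k) (seq z k)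

*-distribˡ-+ : ∀ x y z → x * (y + z) ≃ x * y + x * z
*-distribˡ-+ x y z = pointwise-≃ λ k → ℚ.*-distribˡ-+ (seq x k) (seq y k) (seq z k)

+-cancelʳ-≤ : ∀ z {x y} → x + z ≤ y + z → x ≤ y
+-cancelʳ-≤ z {x} {y} h = begin
  x            ≈⟨ lemma x z ⟨
  (x + z) - z  ≤⟨ +-monoˡ-≤ (- z) h ⟩
  (y + z) - z  ≈⟨ lemma y z ⟩
  y            ∎
  where
  lemma : ∀ x z → (x + z) - z ≃ x
  lemma x z = pointwise-≃ λ k →
    solve 2 (λ x z → (x :+ z) :- z := x) refl (seq x k) (seq z k)

x+y-y≃x : ∀ x y → (x - y) + y ≃ x
x+y-y≃x x y = pointwise-≃ λ k →
  solve 2 (λ x y → (x :- y) :+ y := x) refl (seq x k) (seq y k)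

≤-+⇒-≤ : ∀ {x y z} → x ≤ y + z → x - z ≤ y
≤-+⇒-≤ {x} {y} {z} h = +-cancelʳ-≤ z (≤-trans (proj₁ (x+y-y≃x x z)) h)

-≤⇒≤-+ : ∀ {x y z} → x - z ≤ y → x ≤ y + z
-≤⇒≤-+ {x} {y} {z} h = ≤-trans (proj₂ (x+y-y≃x x z)) (+-monoˡ-≤ z h)

≤⇒0≤ʳ- : ∀ {x y} → x ≤ y → 0ℝ ≤ y - x
≤⇒0≤ʳ- {x} {y} x≤y = +-cancelʳ-≤ x (begin
  0ℝ + x       ≈⟨ pointwise-≃ (λ k → ℚ.+-identityˡ (seq x k)) ⟩
  x            ≤⟨ x≤y ⟩
  y            ≈⟨ x+y-y≃x y x ⟨
  (y - x) + x  ∎)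

0≤ʳ-⇒≤ : ∀ {x y} → 0ℝ ≤ y - x → x ≤ y
0≤ʳ-⇒≤ {x} {y} h = begin
  x            ≈⟨ pointwise-≃ (λ k → ℚ.+-identityˡ (seq x k)) ⟨
  0ℝ + x       ≤⟨ +-monoˡ-≤ x h ⟩
  (y - x) + x  ≈⟨ x+y-y≃x y x ⟩
  y            ∎

-‿anti-≤ : ∀ {x y} → x ≤ y → - y ≤ - x
-‿anti-≤ {x} {y} x≤y = 0≤ʳ-⇒≤ (≤-trans (≤⇒0≤ʳ- x≤y) (proj₁ (pointwise-≃ λ k →
  solve 2 (λ x y → y :- x := (:- x) :- (:- y)) refl (seq x k) (seq y k))))

<⇒≤ : ∀ {x y} → x < y → x ≤ y
<⇒≤ {x} (mk< g 0<g N h) = eventually⇒≤ (N , λ n N≤n → ℚ.≤-trans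
  (ℚ.≤-trans (ℚ.≤-reflexive (sym (ℚ.+-identityʳ (seq x n))))
    (ℚ.+-monoʳ-≤ (seq x n) (ℚ.<⇒≤ 0<g))) (h n N≤n))

<-≤-trans : ∀ {x y z} → x < y → y ≤ z → x < z
<-≤-trans {x} {y} {z} (mk< g 0<g N h) (mk≤ y≤z) =
  let M , k = map₂ {λ n → seq x n ℚ.+ g ℚ.≤ seq y n}
                   {λ n → seq y n ℚ.≤ seq z n ℚ.+ ½ ℚ.* g}
                   {λ n → seq x n ℚ.+ ½ ℚ.* g ℚ.≤ seq z n}
        (λ n p q → 0≤-⇒≤ (subst (0ℚ ℚ.≤_) (lemma (seq x n) (seq z n) g)
          (≤⇒0≤- (ℚ.≤-trans p q)))) (N , h) (y≤z (½ ℚ.* g) (½*-pos 0<g))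
  in mk< (½ ℚ.* g) (½*-pos 0<g) M k
  where
  lemma : ∀ x z g → (z ℚ.+ ½ ℚ.* g) ℚ.- (x ℚ.+ g) ≡ z ℚ.- (x ℚ.+ ½ ℚ.* g)
  lemma = solve 3
    (λ x z g → (z :+ con ½ :* g) :- (x :+ g) := z :- (x :+ con ½ :* g)) refl

<-irrefl : ∀ {x} → ¬ (x < x)
<-irrefl {x} (mk< g 0<g N h) = ℚ.<-irrefl refl (ℚ.<-≤-trans 0<g (0≤-⇒≤ (subst (0ℚ ℚ.≤_)
  (solve 2 (λ x g → x :- (x :+ g) := con 0ℚ :- g) refl (seq x N) g)
  (≤⇒0≤- (h N ℕ.≤-refl)))))

<⇒≱ : ∀ {x y} → x < y → ¬ (y ≤ x)
<⇒≱ x<y y≤x = <-irrefl (<-≤-trans x<y y≤x)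

0<ʳ-⇒< : ∀ {x y} → 0ℝ < y - x → x < y
0<ʳ-⇒< {x} {y} (mk< g 0<g N h) = mk< g 0<g N λ n N≤n → 0≤-⇒≤
  (subst (0ℚ ℚ.≤_) (solve 3 (λ x y g → (y :- x) :- (con 0ℚ :+ g) := y :- (x :+ g)) refl
    (seq x n) (seq y n) g) (≤⇒0≤- (h n N≤n)))

p≤∣p∣ : ∀ p → p ℚ.≤ ℚ.∣ p ∣
p≤∣p∣ p with ℚ.≤-total 0ℚ p
... | inj₁ 0≤p = ℚ.≤-reflexive (sym (ℚ.0≤p⇒∣p∣≡p 0≤p))
... | inj₂ p≤0 = ℚ.≤-trans p≤0 (ℚ.0≤∣p∣ p)

∣p-q∣≤e⇒p≤q+e : ∀ p q {e} → ℚ.∣ p ℚ.- q ∣ ℚ.≤ e → p ℚ.≤ q ℚ.+ e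
∣p-q∣≤e⇒p≤q+e p q h = ℚ.≤-trans
  (ℚ.≤-reflexive (solve 2 (λ p q → p := q :+ (p :- q)) refl p q))
  (ℚ.+-monoʳ-≤ q (ℚ.≤-trans (p≤∣p∣ (p ℚ.- q)) h))

-- A late enough term decides, up to the required accuracy, between x ≤ 0 and 0 < x.
0≮⇒≤0 : ∀ {x} → ¬ (0ℝ < x) → x ≤ 0ℝ
0≮⇒≤0 {x} 0≮x = mk≤ λ ε 0<ε → body ε 0<ε
  where
  body : ∀ ε → 0ℚ ℚ.< ε → Eventually λ n → seq x n ℚ.≤ 0ℚ ℚ.+ ε
  body ε 0<ε with cauchy x (½ ℚ.* (½ ℚ.* ε)) (½*-pos (½*-pos 0<ε))
  ... | N , close with ℚ.≤-total (seq x N) (½ ℚ.* ε)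
  ...   | inj₁ small = N , λ n N≤n →
    ℚ.≤-trans (∣p-q∣≤e⇒p≤q+e (seq x n) (seq x N) (close n N N≤n ℕ.≤-refl))
    (ℚ.≤-trans (ℚ.+-monoˡ-≤ _ small)
    (0≤-⇒≤ (subst (0ℚ ℚ.≤_) (lemma ε) (ℚ.<⇒≤ (½*-pos (½*-pos 0<ε))))))
    where
    lemma : ∀ e → ½ ℚ.* (½ ℚ.* e) ≡ (0ℚ ℚ.+ e) ℚ.- (½ ℚ.* e ℚ.+ ½ ℚ.* (½ ℚ.* e))
    lemma = solve 1 (λ e → con ½ :* (con ½ :* e) :=
      (con 0ℚ :+ e) :- (con ½ :* e :+ con ½ :* (con ½ :* e))) refl
  ...   | inj₂ large = contradiction
    (mk< (½ ℚ.* (½ ℚ.* ε)) (½*-pos (½*-pos 0<ε)) N λ n N≤n →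
      0≤-⇒≤ (subst (0ℚ ℚ.≤_) (lemma (seq x n) ε) (≤⇒0≤-
        (ℚ.≤-trans large (∣p-q∣≤e⇒p≤q+e (seq x N) (seq x n) (close N n ℕ.≤-refl N≤n)))))) 0≮x
    where
    lemma : ∀ x e → (x ℚ.+ ½ ℚ.* (½ ℚ.* e)) ℚ.- ½ ℚ.* e ≡ x ℚ.- (0ℚ ℚ.+ ½ ℚ.* (½ ℚ.* e))
    lemma = solve 2 (λ x e → (x :+ con ½ :* (con ½ :* e)) :- con ½ :* e :=
      x :- (con 0ℚ :+ con ½ :* (con ½ :* e))) refl

≮⇒≥ : ∀ {x y} → ¬ (x < y) → y ≤ x
≮⇒≥ {x} {y} x≮y = begin
  y            ≈⟨ x+y-y≃x y x ⟨
  (y - x) + x  ≤⟨ +-monoˡ-≤ x (0≮⇒≤0 (λ 0<y-x → x≮y (0<ʳ-⇒< 0<y-x))) ⟩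
  0ℝ + x       ≈⟨ pointwise-≃ (λ k → ℚ.+-identityˡ (seq x k)) ⟩
  x            ∎

-- Replaces totality of the order, which is not constructive. The run supplies exactly such
-- negations: increments that fail the threshold and paths that are not almost blocked.
≰⇒≥ : ∀ {x y} → ¬ (x ≤ y) → y ≤ x
≰⇒≥ x≰y = ≮⇒≥ λ x<y → x≰y (<⇒≤ x<y)

-- The fraction is reduced by a gcd that is stuck on a variable `m`; in this normal form, numerator
-- and denominator compute.
/1≡ : ∀ m → + m ℚ./ 1 ≡ mkℚ (+ m) 0 (coprime-sym (1-coprimeTo m))
/1≡ m = ℚ.normalize-coprime (coprime-sym (1-coprimeTo m))

/1-mono-≤ : ∀ {m n} → m ℕ.≤ n → + m ℚ./ 1 ℚ.≤ + n ℚ./ 1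
/1-mono-≤ {m} {n} m≤n = subst₂ ℚ._≤_ (sym (/1≡ m)) (sym (/1≡ n))
  (*≤* (ℤ.*-monoʳ-≤-nonNeg (+ 1) (ℤ.+≤+ m≤n)))

∃natural-bound : ∀ p → ∃[ N ] p ℚ.≤ + N ℚ./ 1
∃natural-bound p@(mkℚ (+ k) d-1 _) = k , subst (p ℚ.≤_) (sym (/1≡ k))
  (*≤* (ℤ.*-monoˡ-≤-nonNeg (+ k) (ℤ.+≤+ (ℕ.s≤s ℕ.z≤n))))
∃natural-bound p@(mkℚ ℤ.-[1+ k ] d-1 _) = 0 , subst (p ℚ.≤_) (sym (/1≡ 0))
  (*≤* ℤ.-≤+)


suc*1/suc : ∀ n → (+ suc n ℚ./ 1) ℚ.* (+ 1 ℚ./ suc n) ≡ 1ℚ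
suc*1/suc n = trans (cong₂ ℚ._*_ (/1≡ (suc n)) eq) (ℚ.*-inverseʳ q)
  where
  q : ℚ
  q = mkℚ (+ suc n) 0 (coprime-sym (1-coprimeTo (suc n)))
  eq : + 1 ℚ./ suc n ≡ ℚ.1/ q
  eq = ℚ.normalize-coprime (1-coprimeTo (suc n))

suc/1 : ∀ n → + suc n ℚ./ 1 ≡ 1ℚ ℚ.+ + n ℚ./ 1
suc/1 n = trans (cong (λ k → k ℚ./ 1) (sym (cong (ℤ._+_ (+ 1)) (ℤ.*-identityʳ (+ n)))))
  (cong (1ℚ ℚ.+_) (sym (/1≡ n)))

bounded : ∀ x → ∃[ B ] Eventually λ n → ℚ.∣ seq x n ∣ ℚ.≤ + B ℚ./ 1
bounded x =
  let N , close = cauchy x 1ℚ (ℚ.positive⁻¹ 1ℚ)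
      B , h     = ∃natural-bound (ℚ.∣ seq x N ∣ ℚ.+ 1ℚ)
  in B , N , λ n N≤n → ℚ.≤-trans
    (ℚ.≤-reflexive (cong ℚ.∣_∣
      (solve 2 (λ p q → p := q :+ (p :- q)) refl (seq x n) (seq x N))))
    (ℚ.≤-trans (ℚ.∣p+q∣≤∣p∣+∣q∣ (seq x N) (seq x n ℚ.- seq x N))
    (ℚ.≤-trans (ℚ.+-monoʳ-≤ ℚ.∣ seq x N ∣ (close n N N≤n ℕ.≤-refl)) h))

-- The terms `a`, `b` are eventually only at least `- δ`. Expanding `(a + δ) * (b + δ) ≥ 0` bounds
-- `a * b` below by `- δ * (a + b + δ)`, and `K` bounds the last factor.
0≤*0≤ : ∀ {x y} → 0ℝ ≤ x → 0ℝ ≤ y → 0ℝ ≤ x * y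
0≤*0≤ {x} {y} (mk≤ 0≤x) (mk≤ 0≤y) = mk≤ λ ε 0<ε →
  let B , x≤B = bounded x
      C , y≤C = bounded y
      K       = (+ B ℚ./ 1 ℚ.+ + C ℚ./ 1) ℚ.+ 1ℚ
      0≤B     = /1-mono-≤ {0} {B} ℕ.z≤n
      0≤C     = /1-mono-≤ {0} {C} ℕ.z≤n
      0<K     = ℚ.+-mono-≤-< (ℚ.+-mono-≤ 0≤B 0≤C) (ℚ.positive⁻¹ 1ℚ)
      -- The cap at 1 pays for the last summand of `a + b + δ`, the `1ℚ` in `K`.
      δ       = recip K ℚ.* ε ℚ.⊓ 1ℚ
      0<δ     = 0<⊓0< (*-pos (0<recip 0<K) 0<ε) (ℚ.positive⁻¹ 1ℚ)
      0≤δ     = ℚ.<⇒≤ 0<δ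
      Kδ≤ε    = ℚ.≤-trans (ℚ.*-monoˡ-≤-nonNeg K {{ℚ.nonNegative (ℚ.<⇒≤ 0<K)}}
                  (ℚ.p⊓q≤p (recip K ℚ.* ε) 1ℚ)) (ℚ.≤-reflexive (K*recipK*ε K ε 0<K))
  in map₂ (λ n (p , u) (q , v) →
       let a = seq x n
           b = seq y n
       in ℚ.≤-trans
         (ℚ.+-mono-≤ (ℚ.+-mono-≤
           (*-nonNeg p q)
           (*-nonNeg 0≤δ (≤⇒0≤- (ℚ.+-mono-≤
             (ℚ.+-mono-≤ (ℚ.≤-trans (p≤∣p∣ a) u) (ℚ.≤-trans (p≤∣p∣ b) v))
             (ℚ.p⊓q≤q (recip K ℚ.* ε) 1ℚ)))))
           (≤⇒0≤- Kδ≤ε))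
         (ℚ.≤-reflexive (lemma a b δ K ε)))
       (map₂ (λ _ → _,_) (0≤x δ 0<δ) x≤B) (map₂ (λ _ → _,_) (0≤y δ 0<δ) y≤C)
  where
  0<⊓0< : ∀ {p q} → 0ℚ ℚ.< p → 0ℚ ℚ.< q → 0ℚ ℚ.< p ℚ.⊓ q
  0<⊓0< {p} {q} 0<p 0<q with ℚ.⊓-sel p q
  ... | inj₁ eq = subst (0ℚ ℚ.<_) (sym eq) 0<p
  ... | inj₂ eq = subst (0ℚ ℚ.<_) (sym eq) 0<q
  K*recipK*ε : ∀ K ε → 0ℚ ℚ.< K → K ℚ.* (recip K ℚ.* ε) ≡ ε
  K*recipK*ε K ε 0<K = trans (sym (ℚ.*-assoc K (recip K) ε))
    (trans (cong (ℚ._* ε) (*-recip 0<K)) (ℚ.*-identityˡ ε))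
  lemma : ∀ a b δ K ε →
    ((a ℚ.+ δ) ℚ.* (b ℚ.+ δ) ℚ.+ δ ℚ.* (K ℚ.- ((a ℚ.+ b) ℚ.+ δ))) ℚ.+ (ε ℚ.- K ℚ.* δ)
      ≡ a ℚ.* b ℚ.+ ε
  lemma = solve 5 (λ a b δ K ε →
    ((a :+ δ) :* (b :+ δ) :+ δ :* (K :- ((a :+ b) :+ δ))) :+ (ε :- K :* δ)
      := a :* b :+ ε) refl

0<*0< : ∀ {x y} → 0ℝ < x → 0ℝ < y → 0ℝ < x * y
0<*0< {x} {y} (mk< g 0<g N p) (mk< h 0<h M q) =
  let K , le = map₂ {λ n → 0ℚ ℚ.+ g ℚ.≤ seq x n} {λ n → 0ℚ ℚ.+ h ℚ.≤ seq y n}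
        {λ n → 0ℚ ℚ.+ g ℚ.* h ℚ.≤ seq x n ℚ.* seq y n}
        (λ n p q → 0≤-⇒≤ (subst (0ℚ ℚ.≤_) (lemma (seq x n) (seq y n) g h)
          (ℚ.+-mono-≤ (ℚ.+-mono-≤ (*-nonNeg (≤⇒0≤- p) (≤⇒0≤- q))
            (*-nonNeg (ℚ.<⇒≤ 0<g) (≤⇒0≤- q))) (*-nonNeg (ℚ.<⇒≤ 0<h) (≤⇒0≤- p)))))
        (N , p) (M , q)
  in mk< (g ℚ.* h) (*-pos 0<g 0<h) K le
  where
  lemma : ∀ a b g h →
    ((a ℚ.- (0ℚ ℚ.+ g)) ℚ.* (b ℚ.- (0ℚ ℚ.+ h)) ℚ.+ g ℚ.* (b ℚ.- (0ℚ ℚ.+ h)))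
      ℚ.+ h ℚ.* (a ℚ.- (0ℚ ℚ.+ g)) ≡ a ℚ.* b ℚ.- (0ℚ ℚ.+ g ℚ.* h)
  lemma = solve 4 (λ a b g h →
    ((a :- (con 0ℚ :+ g)) :* (b :- (con 0ℚ :+ h)) :+ g :* (b :- (con 0ℚ :+ h)))
      :+ h :* (a :- (con 0ℚ :+ g)) := a :* b :- (con 0ℚ :+ g :* h)) refl

*-monoˡ-≤ : ∀ {z x y} → 0ℝ ≤ z → x ≤ y → z * x ≤ z * y
*-monoˡ-≤ {z} {x} {y} 0≤z x≤y = 0≤ʳ-⇒≤ (≤-trans (0≤*0≤ 0≤z (≤⇒0≤ʳ- x≤y))
  (proj₁ (pointwise-≃ λ k → solve 3 (λ x y z → z :* (y :- x) := z :* y :- z :* x) refl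
    (seq x k) (seq y k) (seq z k))))

*-monoʳ-≤ : ∀ {z x y} → 0ℝ ≤ z → x ≤ y → x * z ≤ y * z
*-monoʳ-≤ {z} {x} {y} 0≤z x≤y = begin
  x * z  ≈⟨ *-comm x z ⟩
  z * x  ≤⟨ *-monoˡ-≤ 0≤z x≤y ⟩
  z * y  ≈⟨ *-comm z y ⟩
  y * z  ∎

archimedean : ∀ x → ∃[ N ] - fromℕ N ≤ x × x ≤ fromℕ N
archimedean x =
  let B , M , h = bounded x
  in B
   , eventually⇒≤ (M , λ n M≤n → subst (ℚ.- (+ B ℚ./ 1) ℚ.≤_) (solve 1 (λ p → :- (:- p) := p) refl (seq x n))
       (ℚ.neg-antimono-≤ (ℚ.≤-trans (ℚ.≤-trans (p≤∣p∣ (ℚ.- seq x n))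
         (ℚ.≤-reflexive (ℚ.∣-p∣≡∣p∣ (seq x n)))) (h n M≤n))))
   , eventually⇒≤ (M , λ n M≤n → ℚ.≤-trans (p≤∣p∣ (seq x n)) (h n M≤n))

0≤fromℕ : ∀ n → 0ℝ ≤ fromℕ n
0≤fromℕ n = pointwise-≤ λ _ → /1-mono-≤ {0} {n} ℕ.z≤n

-- The factor x may have either sign: write it as the difference of the
-- nonnegative numbers x + B and B.
*-congˡ : ∀ x {y y′} → y ≃ y′ → x * y ≃ x * y′
*-congˡ x (y≤y′ , y′≤y) =
  let B , -B≤x , _ = archimedean x
  in half (fromℕ B) (0≤fromℕ B) -B≤x y≤y′ y′≤y , half (fromℕ B) (0≤fromℕ B) -B≤x y′≤y y≤y′
  where
  split : ∀ b y → x * y ≃ (x - - b) * y + - (b * y)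
  split b y = pointwise-≃ λ k →
    solve 3 (λ x y b → x :* y := (x :- (:- b)) :* y :+ :- (b :* y)) refl
      (seq x k) (seq y k) (seq b k)
  half : ∀ b {y y′} → 0ℝ ≤ b → - b ≤ x → y ≤ y′ → y′ ≤ y → x * y ≤ x * y′
  half b {y} {y′} 0≤b -b≤x y≤y′ y′≤y = begin
    x * y                         ≈⟨ split b y ⟩
    (x - - b) * y + - (b * y)
      ≤⟨ +-mono-≤ (*-monoˡ-≤ (≤⇒0≤ʳ- -b≤x) y≤y′) (-‿anti-≤ (*-monoˡ-≤ 0≤b y′≤y)) ⟩
    (x - - b) * y′ + - (b * y′)   ≈⟨ split b y′ ⟨
    x * y′                        ∎

*-congʳ : ∀ z {x y} → x ≃ y → x * z ≃ y * z
*-congʳ z {x} {y} x≃y = begin-equality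
  x * z  ≈⟨ *-comm x z ⟩
  z * x  ≈⟨ *-congˡ z x≃y ⟩
  z * y  ≈⟨ *-comm z y ⟩
  y * z  ∎

0<⇒pos : ∀ {x} ((mk< g _ N _) : 0ℝ < x) → ∀ n → N ℕ.≤ n → 0ℚ ℚ.< seq x n
0<⇒pos (mk< g 0<g N h) n N≤n =
  ℚ.<-≤-trans 0<g (ℚ.≤-trans (ℚ.≤-reflexive (sym (ℚ.+-identityˡ g))) (h n N≤n))

*-inv : ∀ {x} (0<x : 0ℝ < x) → x * inv x 0<x ≃ 1ℝ
*-inv {x} 0<x@(mk< g _ N _) =
  eventually⇒≤ (N , λ n N≤n → ℚ.≤-reflexive (*-recip (0<⇒pos 0<x n N≤n))) ,
  eventually⇒≤ (N , λ n N≤n → ℚ.≤-reflexive (sym (*-recip (0<⇒pos 0<x n N≤n))))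

0≤inv : ∀ {x} (0<x : 0ℝ < x) → 0ℝ ≤ inv x 0<x
0≤inv 0<x@(mk< g _ N _) =
  eventually⇒≤ (N , λ n N≤n → ℚ.<⇒≤ (0<recip (0<⇒pos 0<x n N≤n)))

÷-*-cancel : ∀ x {y} (0<y : 0ℝ < y) → (x ÷ y by 0<y) * y ≃ x
÷-*-cancel x {y} 0<y = begin-equality
  (x * inv y 0<y) * y  ≈⟨ *-assoc x (inv y 0<y) y ⟩
  x * (inv y 0<y * y)  ≈⟨ *-congˡ x (*-comm (inv y 0<y) y) ⟩
  x * (y * inv y 0<y)  ≈⟨ *-congˡ x (*-inv 0<y) ⟩
  x * 1ℝ               ≈⟨ *-identityʳ x ⟩
  x                    ∎

≤÷⇒*≤ : ∀ {x y z} (0<z : 0ℝ < z) → x ≤ y ÷ z by 0<z → x * z ≤ y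
≤÷⇒*≤ {y = y} 0<z h = ≤-trans (*-monoʳ-≤ (<⇒≤ 0<z) h) (proj₁ (÷-*-cancel y 0<z))

÷≤⇒≤* : ∀ {x y z} (0<z : 0ℝ < z) → y ÷ z by 0<z ≤ x → y ≤ x * z
÷≤⇒≤* {y = y} 0<z h = ≤-trans (proj₂ (÷-*-cancel y 0<z)) (*-monoʳ-≤ (<⇒≤ 0<z) h)

*-cancelʳ-≤ : ∀ {x y z} → 0ℝ < z → x * z ≤ y * z → x ≤ y
*-cancelʳ-≤ {x} {y} {z} 0<z h = begin
  x                    ≈⟨ cancel x ⟨
  (x * z) * inv z 0<z  ≤⟨ *-monoʳ-≤ (0≤inv 0<z) h ⟩
  (y * z) * inv z 0<z  ≈⟨ cancel y ⟩
  y                    ∎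
  where
  cancel : ∀ x → (x * z) * inv z 0<z ≃ x
  cancel x = begin-equality
    (x * z) * inv z 0<z  ≈⟨ *-assoc x z (inv z 0<z) ⟩
    x * (z * inv z 0<z)  ≈⟨ *-congˡ x (*-inv 0<z) ⟩
    x * 1ℝ               ≈⟨ *-identityʳ x ⟩
    x                    ∎

-- Minimum and truncation

x⊓y≤x : ∀ x y → x ⊓ y ≤ x
x⊓y≤x x y = pointwise-≤ λ k → ℚ.p⊓q≤p (seq x k) (seq y k)

x⊓y≤y : ∀ x y → x ⊓ y ≤ y
x⊓y≤y x y = pointwise-≤ λ k → ℚ.p⊓q≤q (seq x k) (seq y k)

⊓-glb : ∀ {x y z} → z ≤ x → z ≤ y → z ≤ x ⊓ y
⊓-glb {x} {y} {z} (mk≤ p) (mk≤ q) = mk≤ λ ε 0<ε →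
  map₂ (λ n p q → select n p q (ℚ.⊓-sel (seq x n) (seq y n))) (p ε 0<ε) (q ε 0<ε)
  where
  select : ∀ n {ε} → seq z n ℚ.≤ seq x n ℚ.+ ε → seq z n ℚ.≤ seq y n ℚ.+ ε →
           seq x n ℚ.⊓ seq y n ≡ seq x n ⊎ seq x n ℚ.⊓ seq y n ≡ seq y n →
           seq z n ℚ.≤ seq x n ℚ.⊓ seq y n ℚ.+ ε
  select n {ε} p q (inj₁ eq) = subst (λ m → seq z n ℚ.≤ m ℚ.+ ε) (sym eq) p
  select n {ε} p q (inj₂ eq) = subst (λ m → seq z n ℚ.≤ m ℚ.+ ε) (sym eq) q

⊓-monoˡ-≤ : ∀ t {x y} → x ≤ y → x ⊓ t ≤ y ⊓ t
⊓-monoˡ-≤ t {x} x≤y = ⊓-glb (≤-trans (x⊓y≤x x t) x≤y) (x⊓y≤y x t)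

⊓-+-glb : ∀ {x y u z} → z ≤ x + u → z ≤ y + u → z ≤ (x ⊓ y) + u
⊓-+-glb p q = -≤⇒≤-+ (⊓-glb (≤-+⇒-≤ p) (≤-+⇒-≤ q))

+-⊓-glb : ∀ {x y u z} → z ≤ u + x → z ≤ u + y → z ≤ u + (x ⊓ y)
+-⊓-glb {x} {y} {u} p q = ≤-trans
  (⊓-+-glb (≤-trans p (proj₁ (+-comm u x))) (≤-trans q (proj₁ (+-comm u y))))
  (proj₁ (+-comm (x ⊓ y) u))

-- Truncation at t is concave: an increment from a higher start loses more.
⊓-concave : ∀ t {a b c e} → a ≤ b → a ≤ c → a + e ≤ b + c →
            a ⊓ t + e ⊓ t ≤ b ⊓ t + c ⊓ t
⊓-concave t {a} {b} {c} {e} a≤b a≤c a+e≤b+c = ⊓-+-glb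
  (+-⊓-glb
    (≤-trans (+-mono-≤ (x⊓y≤x a t) (x⊓y≤x e t)) a+e≤b+c)
    (+-mono-≤ (≤-trans (x⊓y≤x a t) a≤b) (x⊓y≤y e t)))
  (+-⊓-glb
    (begin
      a ⊓ t + e ⊓ t  ≈⟨ +-comm (a ⊓ t) (e ⊓ t) ⟩
      e ⊓ t + a ⊓ t  ≤⟨ +-mono-≤ (x⊓y≤y e t) (≤-trans (x⊓y≤x a t) a≤c) ⟩
      t + c          ∎)
    (+-mono-≤ (x⊓y≤y a t) (x⊓y≤y e t)))

-- Powers and their tangents

0≤^ : ∀ {x} n → 0ℝ ≤ x → 0ℝ ≤ x ^ n
0≤^ zero    0≤x = pointwise-≤ λ _ → ℚ.nonNegative⁻¹ 1ℚ
0≤^ (suc n) 0≤x = 0≤*0≤ 0≤x (0≤^ n 0≤x)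

0≤x² : ∀ x → 0ℝ ≤ x * x
0≤x² x = pointwise-≤ λ k → square (seq x k)
  where
  square : ∀ p → 0ℚ ℚ.≤ p ℚ.* p
  square p with ℚ.≤-total 0ℚ p
  ... | inj₁ 0≤p = *-nonNeg 0≤p 0≤p
  ... | inj₂ p≤0 = subst (0ℚ ℚ.≤_)
    (solve 1 (λ p → (:- p) :* (:- p) := p :* p) refl p)
    (*-nonNeg (ℚ.neg-antimono-≤ p≤0) (ℚ.neg-antimono-≤ p≤0))

-- The graph of the convex function y ↦ y ^ suc n lies above its tangent at x.
tangent : ∀ {x y} n → 0ℝ ≤ x → 0ℝ ≤ y →
          x ^ n * (x + fromℕ (suc n) * (y - x)) ≤ y ^ suc n
tangent {x} {y} zero    0≤x 0≤y = proj₁ (pointwise-≃ λ k →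
  solve 2 (λ x y → con 1ℚ :* (x :+ con 1ℚ :* (y :- x)) := y :* con 1ℚ) refl
    (seq x k) (seq y k))
tangent {x} {y} (suc n) 0≤x 0≤y = begin
  x ^ suc n * (x + fromℕ (suc (suc n)) * (y - x))
    -- Multiplying the tangent inequality of the lower degree by `y` gives more than the new
    -- tangent; the surplus is `fromℕ (suc n)` times `x ^ n` times the square of `y - x`.
    ≤⟨ 0≤ʳ-⇒≤ (≤-trans (0≤*0≤ (0≤*0≤ (0≤^ n 0≤x) (0≤fromℕ (suc n))) (0≤x² (y - x)))
         (proj₁ (pointwise-≃ λ k → lemma (seq x k) (seq y k) (seq (x ^ n) k)))) ⟩
  y * (x ^ n * (x + fromℕ (suc n) * (y - x)))
    ≤⟨ *-monoˡ-≤ 0≤y (tangent n 0≤x 0≤y) ⟩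
  y * y ^ suc n ∎
  where
  lemma : ∀ x y p →
    (p ℚ.* (+ suc n ℚ./ 1)) ℚ.* ((y ℚ.- x) ℚ.* (y ℚ.- x)) ≡
    y ℚ.* (p ℚ.* (x ℚ.+ (+ suc n ℚ./ 1) ℚ.* (y ℚ.- x)))
      ℚ.- (x ℚ.* p) ℚ.* (x ℚ.+ (+ suc (suc n) ℚ./ 1) ℚ.* (y ℚ.- x))
  lemma x y p rewrite suc/1 (suc n) = solve 4 (λ x y p m →
    (p :* m) :* ((y :- x) :* (y :- x)) :=
    y :* (p :* (x :+ m :* (y :- x))) :- (x :* p) :* (x :+ (con 1ℚ :+ m) :* (y :- x))) refl
    x y p (+ suc n ℚ./ 1)

-- The inequality between the exponential and its compound-interest approximants

-- The sequence inside `IsExp`, so that `IsExp x z` unfolds to its convergence to `z`.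
compound : ℝ → ℕ → ℝ
compound x n = (1ℝ + x * fromℚ (+ 1 ℚ./ suc n)) ^ suc n

suc*-cancel : ∀ n x → fromℕ (suc n) * (x * fromℚ (+ 1 ℚ./ suc n)) ≃ x
suc*-cancel n x = pointwise-≃ λ k → trans
  (lemma (+ suc n ℚ./ 1) (seq x k) (+ 1 ℚ./ suc n))
  (trans (cong (seq x k ℚ.*_) (suc*1/suc n)) (ℚ.*-identityʳ (seq x k)))
  where
  lemma : ∀ m x t → m ℚ.* (x ℚ.* t) ≡ x ℚ.* (m ℚ.* t)
  lemma = solve 3 (λ m x t → m :* (x :* t) := x :* (m :* t)) refl

0≤1/suc : ∀ n → 0ℝ ≤ fromℚ (+ 1 ℚ./ suc n)
0≤1/suc n = pointwise-≤ λ _ → ℚ.nonNegative⁻¹ (+ 1 ℚ./ suc n) {{ℚ.normalize-nonNeg 1 (suc n)}}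

-- Reduces an inequality to a visibly nonnegative expression for the difference and a ring identity
-- on the terms.
≤-by : ∀ {x y z} → 0ℝ ≤ z → (∀ k → seq z k ≡ seq y k ℚ.- seq x k) → x ≤ y
≤-by 0≤z eq = 0≤ʳ-⇒≤ (≤-trans 0≤z (proj₁ (pointwise-≃ eq)))

-- Finite form of `exp (a + x) * (1 - a) ≤ exp x`. With `m = suc n`, the tangent at `b` taken at
-- `c = b - a / m` is `b ^ n * (b - a)`, and `b * (1 - a) ≤ b - a` because `b ≥ 1`.
compound-decay : ∀ {x a} n → 0ℝ ≤ x → 0ℝ ≤ a →
                 compound (a + x) n * (1ℝ - a) ≤ compound x n
compound-decay {x} {a} n 0≤x 0≤a = begin
  b * b ^ n * (1ℝ - a)
    ≤⟨ ≤-by (0≤*0≤ (0≤^ n 0≤b) (0≤*0≤ 0≤a 0≤b-1)) (λ k →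
         solve 3 (λ b p a → p :* (a :* (b :- con 1ℚ)) := p :* (b :- a) :- (b :* p) :* (con 1ℚ :- a))
           refl (seq b k) (seq (b ^ n) k) (seq a k)) ⟩
  b ^ n * (b - a)
    ≈⟨ *-congˡ (b ^ n) (+-cong ≃-refl cancel) ⟨
  b ^ n * (b + fromℕ (suc n) * (c - b))
    ≤⟨ tangent n 0≤b 0≤c ⟩
  c ^ suc n  ∎
  where
  t = fromℚ (+ 1 ℚ./ suc n)
  b = 1ℝ + (a + x) * t
  c = 1ℝ + x * t
  0≤+ : ∀ {y z} → 0ℝ ≤ y → 0ℝ ≤ z → 0ℝ ≤ y + z
  0≤+ 0≤y 0≤z = ≤-trans (proj₂ (+-identityʳ 0ℝ)) (+-mono-≤ 0≤y 0≤z)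
  0≤at+xt : 0ℝ ≤ (a + x) * t
  0≤at+xt = 0≤*0≤ (0≤+ 0≤a 0≤x) (0≤1/suc n)
  0≤b : 0ℝ ≤ b
  0≤b = 0≤+ (0≤fromℕ 1) 0≤at+xt
  0≤c : 0ℝ ≤ c
  0≤c = 0≤+ (0≤fromℕ 1) (0≤*0≤ 0≤x (0≤1/suc n))
  0≤b-1 : 0ℝ ≤ b - 1ℝ
  0≤b-1 = ≤-trans 0≤at+xt (proj₁ (pointwise-≃ λ k →
    solve 1 (λ y → y := (con 1ℚ :+ y) :- con 1ℚ) refl (seq ((a + x) * t) k)))
  cancel : fromℕ (suc n) * (c - b) ≃ - a
  cancel = begin-equality
    fromℕ (suc n) * (c - b)
      ≈⟨ *-congˡ (fromℕ (suc n)) (pointwise-≃ λ k →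
           solve 3 (λ x a t → (con 1ℚ :+ x :* t) :- (con 1ℚ :+ (a :+ x) :* t) := (:- a) :* t)
             refl (seq x k) (seq a k) (+ 1 ℚ./ suc n)) ⟩
    fromℕ (suc n) * (- a * t)  ≈⟨ suc*-cancel n (- a) ⟩
    - a                        ∎

2ℝ : ℝ
2ℝ = 1ℝ + 1ℝ

-- Finite form of `exp x * (1 + a / 2) ≤ exp (x + a)`. The tangent at `b = 1 + x / m` gives the
-- factor `1 + a / b`, which for `b > 1` and `a > 0` is less than `1 + a`. Once `m` exceeds the
-- absolute value of `x`, `b` lies between 0 and 2, whence the weaker factor with `a / 2`.
compound-growth : ∀ x {a} → 0ℝ ≤ a →
  ∃[ N ] ∀ n → N ℕ.≤ n → compound x n * (2ℝ + a) ≤ 2ℝ * compound (x + a) n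
compound-growth x {a} 0≤a =
  let N , -N≤x , x≤N = archimedean x
  in N , λ n N≤n → bound n (≤-trans (-‿anti-≤ (N≤m N n N≤n)) -N≤x) (≤-trans x≤N (N≤m N n N≤n))
  where
  N≤m : ∀ N n → N ℕ.≤ n → fromℕ N ≤ fromℕ (suc n)
  N≤m N n N≤n = pointwise-≤ λ _ → /1-mono-≤ (ℕ.m≤n⇒m≤1+n N≤n)
  bound : ∀ n → - fromℕ (suc n) ≤ x → x ≤ fromℕ (suc n) →
          compound x n * (2ℝ + a) ≤ 2ℝ * compound (x + a) n
  bound n -m≤x x≤m = begin
    b * b ^ n * (2ℝ + a)
      ≤⟨ ≤-by (0≤*0≤ (0≤^ n 0≤b) (0≤*0≤ 0≤a (≤⇒0≤ʳ- b≤2))) (λ k →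
           solve 3 (λ b p a → p :* (a :* ((con 1ℚ :+ con 1ℚ) :- b)) :=
             (con 1ℚ :+ con 1ℚ) :* (p :* (b :+ a)) :- (b :* p) :* ((con 1ℚ :+ con 1ℚ) :+ a))
             refl (seq b k) (seq (b ^ n) k) (seq a k)) ⟩
    2ℝ * (b ^ n * (b + a))
      ≈⟨ *-congˡ 2ℝ (*-congˡ (b ^ n) (+-cong ≃-refl cancel)) ⟨
    2ℝ * (b ^ n * (b + fromℕ (suc n) * (c - b)))
      ≤⟨ *-monoˡ-≤ 0≤2 (tangent n 0≤b 0≤c) ⟩
    2ℝ * c ^ suc n  ∎
    where
    t = fromℚ (+ 1 ℚ./ suc n)
    b = 1ℝ + x * t
    c = 1ℝ + (x + a) * t
    0≤2 : 0ℝ ≤ 2ℝ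
    0≤2 = pointwise-≤ λ _ → ℚ.nonNegative⁻¹ (1ℚ ℚ.+ 1ℚ)
    mt≃1 : fromℕ (suc n) * t ≃ 1ℝ
    mt≃1 = pointwise-≃ λ _ → suc*1/suc n
    b≤2 : b ≤ 2ℝ
    b≤2 = +-monoʳ-≤ 1ℝ (≤-trans (*-monoʳ-≤ (0≤1/suc n) x≤m) (proj₁ mt≃1))
    0≤b : 0ℝ ≤ b
    0≤b = begin
      0ℝ                         ≈⟨ pointwise-≃ (λ _ → ℚ.+-inverseʳ 1ℚ) ⟨
      1ℝ - 1ℝ                    ≤⟨ +-monoʳ-≤ 1ℝ (-‿anti-≤ (proj₁ mt≃1)) ⟩
      1ℝ - fromℕ (suc n) * t     ≈⟨ +-cong ≃-refl (pointwise-≃ λ _ →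
          solve 2 (λ m t → :- (m :* t) := (:- m) :* t) refl (+ suc n ℚ./ 1) (+ 1 ℚ./ suc n)) ⟩
      1ℝ + - fromℕ (suc n) * t   ≤⟨ +-monoʳ-≤ 1ℝ (*-monoʳ-≤ (0≤1/suc n) -m≤x) ⟩
      b                          ∎
    b≤c : b ≤ c
    b≤c = +-monoʳ-≤ 1ℝ (*-monoʳ-≤ (0≤1/suc n) (begin
      x       ≈⟨ +-identityʳ x ⟨
      x + 0ℝ  ≤⟨ +-monoʳ-≤ x 0≤a ⟩
      x + a   ∎))
    0≤c : 0ℝ ≤ c
    0≤c = ≤-trans 0≤b b≤c
    cancel : fromℕ (suc n) * (c - b) ≃ a
    cancel = begin-equality
      fromℕ (suc n) * (c - b)
        ≈⟨ *-congˡ (fromℕ (suc n)) (pointwise-≃ λ k →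
             solve 3 (λ x a t → (con 1ℚ :+ (x :+ a) :* t) :- (con 1ℚ :+ x :* t) := a :* t)
               refl (seq x k) (seq a k) (+ 1 ℚ./ suc n)) ⟩
      fromℕ (suc n) * (a * t)  ≈⟨ suc*-cancel n a ⟩
      a                        ∎

-- If l < x, the approximants at x exceed those at l by a fixed factor
-- 1 + (x - l) / 2, so they could not stay below the limit z of the latter.
compound≤exp : ∀ {x l z} → 0ℝ < z → IsExp l z → (∀ n → compound x n ≤ z) → x ≤ l
compound≤exp {x} {l} {z} 0<z exp-l x≤z = ≮⇒≥ λ l<x → absurd (x<y⇒0<y-x l<x)
  where
  absurd : ¬ (0ℝ < x - l)
  absurd 0<a =
    <⇒≱ (0<*0< 0<z 0<a) (begin
      z * a     ≈⟨ ÷-*-cancel (z * a) 0<2+a ⟨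
      ρ * c     ≤⟨ *-monoʳ-≤ (<⇒≤ 0<2+a) (0≮⇒≤0 too-large) ⟩
      0ℝ * c    ≈⟨ pointwise-≃ (λ k → ℚ.*-zeroˡ (seq c k)) ⟩
      0ℝ        ∎)
    where
    a = x - l
    c = 2ℝ + a
    0<2+a : 0ℝ < c
    0<2+a = <-≤-trans 0<a (≤-by (pointwise-≤ {0ℝ} {2ℝ} λ _ → ℚ.nonNegative⁻¹ (1ℚ ℚ.+ 1ℚ))
      λ k → solve 1 (λ a → con 1ℚ :+ con 1ℚ := ((con 1ℚ :+ con 1ℚ) :+ a) :- a) refl (seq a k))
    -- Chosen so that `(z - ρ) * c` is `2ℝ * z`: growth then keeps every late `compound l n` at or
    -- below `z - ρ`, against convergence to `z` if `ρ` were positive.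
    ρ = (z * a) ÷ c by 0<2+a
    too-large : ¬ (0ℝ < ρ)
    too-large 0<ρ =
      let N , near = exp-l ρ 0<ρ
          M , grow = compound-growth l (<⇒≤ 0<a)
          n        = N ℕ.⊔ M
      in <⇒≱ (proj₁ (near n (ℕ.m≤m⊔n N M))) (*-cancelʳ-≤ 0<2+a (begin
        compound l n * c             ≤⟨ grow n (ℕ.m≤n⊔m N M) ⟩
        2ℝ * compound (l + a) n      ≤⟨ *-monoˡ-≤ (pointwise-≤ λ _ → ℚ.nonNegative⁻¹ (1ℚ ℚ.+ 1ℚ))
                                          (≤-trans (shift n) (x≤z n)) ⟩
        2ℝ * z                       ≈⟨ pointwise-≃ (λ k → solve 2 (λ z a →
            (con 1ℚ :+ con 1ℚ) :* z := z :* ((con 1ℚ :+ con 1ℚ) :+ a) :+ (:- (z :* a)))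
            refl (seq z k) (seq a k)) ⟩
        z * c + - (z * a)            ≈⟨ +-cong ≃-refl (-‿cong (÷-*-cancel (z * a) 0<2+a)) ⟨
        z * c + - (ρ * c)            ≈⟨ pointwise-≃ (λ k → solve 3 (λ z ρ c →
            z :* c :+ (:- (ρ :* c)) := (z :- ρ) :* c) refl (seq z k) (seq ρ k) (seq c k)) ⟩
        (z - ρ) * c                  ∎))
      where
      -‿cong : ∀ {x y} → x ≃ y → - x ≃ - y
      -‿cong (p , q) = -‿anti-≤ q , -‿anti-≤ p
      shift : ∀ n → compound (l + a) n ≤ compound x n
      shift n = proj₁ (pointwise-≃ λ k → ^-seq
        {1ℝ + (l + a) * fromℚ (+ 1 ℚ./ suc n)} {1ℝ + x * fromℚ (+ 1 ℚ./ suc n)} k (suc n)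
        (cong (λ y → 1ℚ ℚ.+ y ℚ.* (+ 1 ℚ./ suc n))
          (solve 2 (λ l x → l :+ (x :- l) := x) refl (seq l k) (seq x k))))
        where
        ^-seq : ∀ {x y} k n → seq x k ≡ seq y k → seq (x ^ n) k ≡ seq (y ^ n) k
        ^-seq k zero    eq = refl
        ^-seq k (suc n) eq = cong₂ ℚ._*_ eq (^-seq k n eq)

-- Finite sums

x≤x+y : ∀ x {y} → 0ℝ ≤ y → x ≤ x + y
x≤x+y x 0≤y = ≤-trans (proj₂ (+-identityʳ x)) (+-monoʳ-≤ x 0≤y)

x≤y+x : ∀ x {y} → 0ℝ ≤ y → x ≤ y + x
x≤y+x x {y} 0≤y = ≤-trans (x≤x+y x 0≤y) (proj₁ (+-comm x y))

+-interchange : ∀ x y u v → (x + y) + (u + v) ≃ (x + u) + (y + v)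
+-interchange x y u v = pointwise-≃ λ k →
  solve 4 (λ x y u v → (x :+ y) :+ (u :+ v) := (x :+ u) :+ (y :+ v)) refl
    (seq x k) (seq y k) (seq u k) (seq v k)

module _ {A : Set} where

  sum-mono : ∀ {g h : A → ℝ} as → (∀ {a} → a ∈ as → g a ≤ h a) → sum g as ≤ sum h as
  sum-mono []       g≤h = ≤-refl
  sum-mono (a ∷ as) g≤h = +-mono-≤ (g≤h (here refl)) (sum-mono as λ a∈as → g≤h (there a∈as))

  sum-cong : ∀ {g h : A → ℝ} as → (∀ a → g a ≃ h a) → sum g as ≃ sum h as
  sum-cong as g≃h = sum-mono as (λ {a} _ → proj₁ (g≃h a)) , sum-mono as (λ {a} _ → proj₂ (g≃h a))

  sum-+ : ∀ (g h : A → ℝ) as → sum g as + sum h as ≃ sum (λ a → g a + h a) as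
  sum-+ g h []       = +-identityʳ 0ℝ
  sum-+ g h (a ∷ as) = begin-equality
    (g a + sum g as) + (h a + sum h as)  ≈⟨ +-interchange (g a) (sum g as) (h a) (sum h as) ⟩
    (g a + h a) + (sum g as + sum h as)  ≈⟨ +-cong ≃-refl (sum-+ g h as) ⟩
    sum (λ a → g a + h a) (a ∷ as)       ∎

  *-sum : ∀ x (g : A → ℝ) as → x * sum g as ≃ sum (λ a → x * g a) as
  *-sum x g []       = pointwise-≃ λ k → ℚ.*-zeroʳ (seq x k)
  *-sum x g (a ∷ as) = begin-equality
    x * (g a + sum g as)      ≈⟨ *-distribˡ-+ x (g a) (sum g as) ⟩
    x * g a + x * sum g as    ≈⟨ +-cong ≃-refl (*-sum x g as) ⟩
    sum (λ a → x * g a) (a ∷ as) ∎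

  sum-const : ∀ x (as : List A) → sum (λ _ → x) as ≃ fromℕ (length as) * x
  sum-const x []       = pointwise-≃ λ k → sym (ℚ.*-zeroˡ (seq x k))
  sum-const x (a ∷ as) = begin-equality
    x + sum (λ _ → x) as           ≈⟨ +-cong ≃-refl (sum-const x as) ⟩
    x + fromℕ (length as) * x      ≈⟨ pointwise-≃ (λ k → lemma (length as) (seq x k)) ⟩
    fromℕ (suc (length as)) * x    ∎
    where
    lemma : ∀ n p → p ℚ.+ (+ n ℚ./ 1) ℚ.* p ≡ (+ suc n ℚ./ 1) ℚ.* p
    lemma n p = trans
      (solve 2 (λ m p → p :+ m :* p := (con 1ℚ :+ m) :* p) refl (+ n ℚ./ 1) p)
      (cong (ℚ._* p) (sym (suc/1 n)))

  0≤sum : ∀ {g : A → ℝ} as → (∀ a → 0ℝ ≤ g a) → 0ℝ ≤ sum g as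
  0≤sum         []       0≤g = ≤-refl
  0≤sum {g = g} (a ∷ as) 0≤g = ≤-trans (0≤g a) (x≤x+y (g a) (0≤sum as 0≤g))

  term≤sum : ∀ {g : A → ℝ} {a as} → (∀ a → 0ℝ ≤ g a) → a ∈ as → g a ≤ sum g as
  term≤sum {g} {a} {_ ∷ as} 0≤g (here refl)  = x≤x+y (g a) (0≤sum as 0≤g)
  term≤sum {g} {a} {b ∷ as} 0≤g (there a∈as) =
    ≤-trans (term≤sum 0≤g a∈as) (x≤y+x (sum g as) (0≤g b))

  sum-interleaving : ∀ (g : A → ℝ) {ls rs as} → Interleaving ls rs as →
                     sum g ls + sum g rs ≃ sum g as
  sum-interleaving g []                                = +-identityʳ 0ℝ
  sum-interleaving g {a ∷ ls} {rs} {_ ∷ as} (consˡ i)  = begin-equality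
    (g a + sum g ls) + sum g rs  ≈⟨ +-assoc (g a) (sum g ls) (sum g rs) ⟩
    g a + (sum g ls + sum g rs)  ≈⟨ +-cong ≃-refl (sum-interleaving g i) ⟩
    g a + sum g as               ∎
  sum-interleaving g {ls} {a ∷ rs} {_ ∷ as} (consʳ i)  = begin-equality
    sum g ls + (g a + sum g rs)  ≈⟨ lemma (sum g ls) (g a) (sum g rs) ⟩
    g a + (sum g ls + sum g rs)  ≈⟨ +-cong ≃-refl (sum-interleaving g i) ⟩
    g a + sum g as               ∎
    where
    lemma : ∀ x y z → x + (y + z) ≃ y + (x + z)
    lemma x y z = pointwise-≃ λ k →
      solve 3 (λ x y z → x :+ (y :+ z) := y :+ (x :+ z)) refl (seq x k) (seq y k) (seq z k)

  All-interleavingʳ : ∀ {Q : A → Set} {ls rs as} → Interleaving ls rs as → All Q as → All Q rs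
  All-interleavingʳ []        []       = []
  All-interleavingʳ (consˡ i) (q ∷ qs) = All-interleavingʳ i qs
  All-interleavingʳ (consʳ i) (q ∷ qs) = q ∷ All-interleavingʳ i qs

  sum-interleavingʳ-≤ : ∀ (g : A → ℝ) {ls rs as} → (∀ a → 0ℝ ≤ g a) →
                        Interleaving ls rs as → sum g rs ≤ sum g as
  sum-interleavingʳ-≤ g {ls} {rs} 0≤g i =
    ≤-trans (x≤y+x (sum g rs) (0≤sum ls 0≤g)) (proj₁ (sum-interleaving g i))

-- Path lengths and marginal gains

module _ (𝒩 : Network) where
  open ThresholdBlocking 𝒩

  ⟨⟩-here : ∀ v y → ⟨ v , y ⟩ v ≡ y
  ⟨⟩-here v y with v ≟ v
  ... | yes _  = refl
  ... | no v≢v = contradiction refl v≢v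

  ⟨⟩-there : ∀ {u v} y → u ≢ v → ⟨ v , y ⟩ u ≡ 0≥0
  ⟨⟩-there {u} {v} y u≢v with u ≟ v
  ... | yes u≡v = contradiction u≡v u≢v
  ... | no _    = refl

  -- Unlike a with-abstraction over u ≟ v, splitting on this disjunction leaves the
  -- ⟨ v , y ⟩ u in the goal, and the reals around it, unreduced.
  same-or-not : ∀ (u v : V) → u ≡ v ⊎ u ≢ v
  same-or-not u v with u ≟ v
  ... | yes u≡v = inj₁ u≡v
  ... | no u≢v  = inj₂ u≢v

  val-≡ : ∀ {a b : ℝ≥0} → a ≡ b → val a ≃ val b
  val-≡ refl = ≃-refl

  ≤ᵛ-⊕ : ∀ w s → w ≤ᵛ w ⊕ s
  ≤ᵛ-⊕ w s v = x≤x+y (val (w v)) (nonNeg (s v))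

  ⊕-assoc : ∀ w s t v → val (((w ⊕ s) ⊕ t) v) ≃ val ((w ⊕ (s ⊕ t)) v)
  ⊕-assoc w s t v = +-assoc (val (w v)) (val (s v)) (val (t v))

  ⊕-⟨⟩-there : ∀ w {u v} y → u ≢ v → val ((w ⊕ ⟨ v , y ⟩) u) ≃ val (w u)
  ⊕-⟨⟩-there w {u} {v} y u≢v = begin-equality
    val (w u) + val (⟨ v , y ⟩ u)  ≈⟨ +-cong ≃-refl (val-≡ (⟨⟩-there y u≢v)) ⟩
    val (w u) + 0ℝ                 ≈⟨ +-identityʳ (val (w u)) ⟩
    val (w u)                      ∎

  weight-mono : ∀ {w w′} → w ≤ᵛ w′ → ∀ p → weight w p ≤ weight w′ p
  weight-mono w≤w′ p = sum-mono p λ {v} _ → f-mono v (w≤w′ v)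

  d-mono : ∀ {w w′} → w ≤ᵛ w′ → ∀ p → d w p ≤ d w′ p
  d-mono w≤w′ p = ⊓-monoˡ-≤ T (weight-mono w≤w′ p)

  0≤weight : ∀ w p → 0ℝ ≤ weight w p
  0≤weight w p = 0≤sum p λ v → nonNeg (f v (w v))

  deficit : List Path → Impact → ℝ
  deficit P w = sum (λ p → T - d w p) P

  0≤T-d : ∀ w p → 0ℝ ≤ T - d w p
  0≤T-d w p = ≤⇒0≤ʳ- (x⊓y≤y (weight w p) T)

  deficit-anti : ∀ {w w′} P → w ≤ᵛ w′ → deficit P w′ ≤ deficit P w
  deficit-anti P w≤w′ = sum-mono P λ {p} _ → +-monoʳ-≤ T (-‿anti-≤ (d-mono w≤w′ p))

  -- Expresses gains as drops of the deficit. Inequalities on `r` then follow by adding a deficit to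
  -- both sides and using its monotonicity.
  r+deficit : ∀ P w v y → r P w v y + deficit P (w ⊕ ⟨ v , y ⟩) ≃ deficit P w
  r+deficit P w v y = begin-equality
    r P w v y + deficit P (w ⊕ ⟨ v , y ⟩)
      ≈⟨ sum-+ (λ p → d (w ⊕ ⟨ v , y ⟩) p - d w p) (λ p → T - d (w ⊕ ⟨ v , y ⟩) p) P ⟩
    sum (λ p → (d (w ⊕ ⟨ v , y ⟩) p - d w p) + (T - d (w ⊕ ⟨ v , y ⟩) p)) P
      ≈⟨ sum-cong P (λ p → lemma (d (w ⊕ ⟨ v , y ⟩) p) (d w p) T) ⟩
    deficit P w  ∎
    where
    lemma : ∀ a b t → (a - b) + (t - a) ≃ t - b
    lemma a b t = pointwise-≃ λ k →
      solve 3 (λ a b t → (a :- b) :+ (t :- a) := t :- b) refl (seq a k) (seq b k) (seq t k)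

  0≤gain : ∀ w v y p → 0ℝ ≤ d (w ⊕ ⟨ v , y ⟩) p - d w p
  0≤gain w v y p = ≤⇒0≤ʳ- (d-mono (≤ᵛ-⊕ w ⟨ v , y ⟩) p)

  0≤r : ∀ P w v y → 0ℝ ≤ r P w v y
  0≤r P w v y = 0≤sum P (0≤gain w v y)

  -- The two hypotheses make `w` and `w′` agree at `v`, so the increment has the same effect on
  -- `f v` from both; at other nodes it has none. If `w′` were larger at `v`, a jump of `f v` could
  -- break this.
  weight-diminishing : ∀ {w w′ v} y p → w ≤ᵛ w′ → val (w′ v) ≤ val (w v) →
    weight w p + weight (w′ ⊕ ⟨ v , y ⟩) p ≤ weight w′ p + weight (w ⊕ ⟨ v , y ⟩) p
  weight-diminishing {w} {w′} {v} y p w≤w′ w′v≤wv = begin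
    weight w p + weight (w′ ⊕ ⟨ v , y ⟩) p
      ≈⟨ sum-+ (λ u → at u w) (λ u → at u (w′ ⊕ ⟨ v , y ⟩)) p ⟩
    sum (λ u → at u w + at u (w′ ⊕ ⟨ v , y ⟩)) p
      ≤⟨ sum-mono p (λ {u} _ → pointwise u (same-or-not u v)) ⟩
    sum (λ u → at u w′ + at u (w ⊕ ⟨ v , y ⟩)) p
      ≈⟨ sum-+ (λ u → at u w′) (λ u → at u (w ⊕ ⟨ v , y ⟩)) p ⟨
    weight w′ p + weight (w ⊕ ⟨ v , y ⟩) p  ∎
    where
    at : V → Impact → ℝ
    at u w = val (f u (w u))
    pointwise : ∀ u → u ≡ v ⊎ u ≢ v →
      at u w + at u (w′ ⊕ ⟨ v , y ⟩) ≤ at u w′ + at u (w ⊕ ⟨ v , y ⟩)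
    pointwise u (inj₁ refl) = +-mono-≤ (f-mono u (w≤w′ u))
      (f-mono u (+-monoˡ-≤ (val (⟨ v , y ⟩ u)) w′v≤wv))
    pointwise u (inj₂ u≢v) = begin
      at u w + at u (w′ ⊕ ⟨ v , y ⟩)
        ≤⟨ +-mono-≤ (f-mono u (≤ᵛ-⊕ w ⟨ v , y ⟩ u)) (f-mono u (proj₁ (⊕-⟨⟩-there w′ y u≢v))) ⟩
      at u (w ⊕ ⟨ v , y ⟩) + at u w′  ≈⟨ +-comm (at u (w ⊕ ⟨ v , y ⟩)) (at u w′) ⟩
      at u w′ + at u (w ⊕ ⟨ v , y ⟩)  ∎

  -- Raising other nodes only brings paths closer to the cap T.
  r-diminishing : ∀ {w w′ v} P y → w ≤ᵛ w′ → val (w′ v) ≤ val (w v) →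
                  r P w′ v y ≤ r P w v y
  r-diminishing {w} {w′} {v} P y w≤w′ w′v≤wv = sum-mono P λ {p} _ →
    rearrange (⊓-concave T (weight-mono w≤w′ p) (weight-mono (≤ᵛ-⊕ w ⟨ v , y ⟩) p)
      (weight-diminishing y p w≤w′ w′v≤wv))
    where
    rearrange : ∀ {a b c e} → a + e ≤ b + c → e - b ≤ c - a
    rearrange {a} {b} {c} {e} h = ≤-by (≤⇒0≤ʳ- h) λ k →
      solve 4 (λ a b c e → (b :+ c) :- (a :+ e) := (c :- a) :- (e :- b)) refl
        (seq a k) (seq b k) (seq c k) (seq e k)

  r-interleavingʳ-≤ : ∀ {removed P′ P} w v y → Interleaving removed P′ P → r P′ w v y ≤ r P w v y
  r-interleavingʳ-≤ w v y i = sum-interleavingʳ-≤ _ (0≤gain w v y) i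

  -- Two successive increments at one node telescope. `w′` is given only up to `≃` because the run
  -- accumulates increments in `s`, and reassociating `x ⊕ (s ⊕ ⟨ v , y ⟩)` is not definitional.
  r-+ : ∀ {w w′ v} P y z → (∀ u → val (w′ u) ≃ val ((w ⊕ ⟨ v , y ⟩) u)) →
        r P w v y + r P w′ v z ≤ r P w v (y +≥0 z)
  r-+ {w} {w′} {v} P y z w′≃ = +-cancelʳ-≤ (deficit P (w ⊕ ⟨ v , y +≥0 z ⟩)) (begin
    (r P w v y + r P w′ v z) + deficit P (w ⊕ ⟨ v , y +≥0 z ⟩)
      ≤⟨ +-monoʳ-≤ (r P w v y + r P w′ v z) (deficit-anti P w′z≤) ⟩
    (r P w v y + r P w′ v z) + deficit P (w′ ⊕ ⟨ v , z ⟩)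
      ≈⟨ +-assoc (r P w v y) (r P w′ v z) (deficit P (w′ ⊕ ⟨ v , z ⟩)) ⟩
    r P w v y + (r P w′ v z + deficit P (w′ ⊕ ⟨ v , z ⟩))
      ≈⟨ +-cong ≃-refl (r+deficit P w′ v z) ⟩
    r P w v y + deficit P w′
      ≤⟨ +-monoʳ-≤ (r P w v y) (deficit-anti P (λ u → proj₂ (w′≃ u))) ⟩
    r P w v y + deficit P (w ⊕ ⟨ v , y ⟩)
      ≈⟨ r+deficit P w v y ⟩
    deficit P w
      ≈⟨ r+deficit P w v (y +≥0 z) ⟨
    r P w v (y +≥0 z) + deficit P (w ⊕ ⟨ v , y +≥0 z ⟩)  ∎)
    where
    ⟨⟩-+ : ∀ u → u ≡ v ⊎ u ≢ v →
           val (⟨ v , y ⟩ u) + val (⟨ v , z ⟩ u) ≤ val (⟨ v , y +≥0 z ⟩ u)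
    ⟨⟩-+ u (inj₁ refl) = begin
      val (⟨ v , y ⟩ v) + val (⟨ v , z ⟩ v)
        ≈⟨ +-cong (val-≡ (⟨⟩-here v y)) (val-≡ (⟨⟩-here v z)) ⟩
      val y + val z             ≈⟨ val-≡ (⟨⟩-here v (y +≥0 z)) ⟨
      val (⟨ v , y +≥0 z ⟩ v)   ∎
    ⟨⟩-+ u (inj₂ u≢v) = begin
      val (⟨ v , y ⟩ u) + val (⟨ v , z ⟩ u)
        ≈⟨ +-cong (val-≡ (⟨⟩-there y u≢v)) (val-≡ (⟨⟩-there z u≢v)) ⟩
      0ℝ + 0ℝ                   ≈⟨ +-identityʳ 0ℝ ⟩
      0ℝ                        ≤⟨ nonNeg (⟨ v , y +≥0 z ⟩ u) ⟩
      val (⟨ v , y +≥0 z ⟩ u)   ∎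
    w′z≤ : w′ ⊕ ⟨ v , z ⟩ ≤ᵛ w ⊕ ⟨ v , y +≥0 z ⟩
    w′z≤ u = begin
      val (w′ u) + val (⟨ v , z ⟩ u)
        ≤⟨ +-monoˡ-≤ (val (⟨ v , z ⟩ u)) (proj₁ (w′≃ u)) ⟩
      (val (w u) + val (⟨ v , y ⟩ u)) + val (⟨ v , z ⟩ u)
        ≈⟨ +-assoc (val (w u)) (val (⟨ v , y ⟩ u)) (val (⟨ v , z ⟩ u)) ⟩
      val (w u) + (val (⟨ v , y ⟩ u) + val (⟨ v , z ⟩ u))
        ≤⟨ +-monoʳ-≤ (val (w u)) (⟨⟩-+ u (same-or-not u v)) ⟩
      val (w u) + val (⟨ v , y +≥0 z ⟩ u)  ∎

  r-≤0 : ∀ P w v y → val y ≤ 0ℝ → r P w v y ≤ 0ℝ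
  r-≤0 P w v y y≤0 = +-cancelʳ-≤ (deficit P (w ⊕ ⟨ v , y ⟩)) (begin
    r P w v y + deficit P (w ⊕ ⟨ v , y ⟩)  ≈⟨ r+deficit P w v y ⟩
    deficit P w                            ≤⟨ deficit-anti P wy≤w ⟩
    deficit P (w ⊕ ⟨ v , y ⟩)              ≤⟨ x≤y+x (deficit P (w ⊕ ⟨ v , y ⟩)) ≤-refl ⟩
    0ℝ + deficit P (w ⊕ ⟨ v , y ⟩)         ∎)
    where
    ⟨⟩≤0 : ∀ u → u ≡ v ⊎ u ≢ v → val (⟨ v , y ⟩ u) ≤ 0ℝ
    ⟨⟩≤0 u (inj₁ refl) = ≤-trans (proj₁ (val-≡ (⟨⟩-here v y))) y≤0
    ⟨⟩≤0 u (inj₂ u≢v)  = proj₁ (val-≡ (⟨⟩-there y u≢v))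
    wy≤w : w ⊕ ⟨ v , y ⟩ ≤ᵛ w
    wy≤w u = ≤-trans (+-monoʳ-≤ (val (w u)) (⟨⟩≤0 u (same-or-not u v)))
      (proj₁ (+-identityʳ (val (w u))))

  -- Whether `y` is zero or positive cannot be decided, but `≤` may be proved by contradiction: a
  -- failure at `y` excludes `0ℝ < val y`, and at `val y ≃ 0ℝ` both sides vanish.
  r-bound-extend : ∀ P w v M → (∀ y → 0ℝ < val y → r P w v y ≤ M * val y) →
                   ∀ y → r P w v y ≤ M * val y
  r-bound-extend P w v M bound y = ≮⇒≥ λ My<r →
    let y≤0 = 0≮⇒≤0 λ 0<y → <⇒≱ My<r (bound y 0<y)
    in <⇒≱ My<r (begin
      r P w v y  ≤⟨ r-≤0 P w v y y≤0 ⟩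
      0ℝ         ≈⟨ pointwise-≃ (λ k → ℚ.*-zeroʳ (seq M k)) ⟨
      M * 0ℝ     ≈⟨ *-congˡ M (y≤0 , nonNeg y) ⟨
      M * val y  ∎)

  -- For `vs` without repetitions this is `s` restricted to `vs`, built from single-node increments
  -- so that `r` measures each of them.
  spread : Impact → List V → Impact
  spread s []       = 𝟎
  spread s (v ∷ vs) = spread s vs ⊕ ⟨ v , s v ⟩

  spread-absent : ∀ s {v vs} → All (v ≢_) vs → val (spread s vs v) ≤ 0ℝ
  spread-absent s []                              = ≤-refl
  spread-absent s {v} {u ∷ vs} (v≢u ∷ v∉vs) =
    ≤-trans (proj₁ (⊕-⟨⟩-there (spread s vs) (s u) v≢u)) (spread-absent s v∉vs)

  ≤-spread : ∀ s {v vs} → v ∈ vs → val (s v) ≤ val (spread s vs v)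
  ≤-spread s {v} {_ ∷ vs} (here refl) = begin
    val (s v)                                    ≈⟨ val-≡ (⟨⟩-here v (s v)) ⟨
    val (⟨ v , s v ⟩ v)                          ≤⟨ x≤y+x (val (⟨ v , s v ⟩ v)) (nonNeg (spread s vs v)) ⟩
    val (spread s vs v) + val (⟨ v , s v ⟩ v)    ∎
  ≤-spread s {v} {u ∷ vs} (there v∈vs) =
    ≤-trans (≤-spread s v∈vs) (≤ᵛ-⊕ (spread s vs) ⟨ u , s u ⟩ v)

  -- When the increment at `v` is added, only nodes of `vs` have been raised, and `v` is not among
  -- them by uniqueness. Diminishing returns therefore bound its gain by the gain at the starting
  -- vector `w`.
  deficit-≤-sum : ∀ P w s {vs} → Unique vs →
    deficit P w ≤ sum (λ v → r P w v (s v)) vs + deficit P (w ⊕ spread s vs)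
  deficit-≤-sum P w s [] = ≤-trans
    (deficit-anti P λ v → proj₁ (+-identityʳ (val (w v))))
    (x≤y+x (deficit P (w ⊕ 𝟎)) ≤-refl)
  deficit-≤-sum P w s {v ∷ vs} (v∉vs ∷ uniq) = begin
    deficit P w                 ≤⟨ deficit-≤-sum P w s uniq ⟩
    Σr + deficit P w′           ≈⟨ +-cong ≃-refl (r+deficit P w′ v (s v)) ⟨
    Σr + (r P w′ v (s v) + deficit P (w′ ⊕ ⟨ v , s v ⟩))
      ≤⟨ +-monoʳ-≤ Σr (+-mono-≤
           (r-diminishing P (s v) (≤ᵛ-⊕ w (spread s vs)) w′v≤wv)
           (deficit-anti P λ u → proj₂ (⊕-assoc w (spread s vs) ⟨ v , s v ⟩ u))) ⟩
    Σr + (r P w v (s v) + deficit P (w ⊕ spread s (v ∷ vs)))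
      ≈⟨ rearrange Σr (r P w v (s v)) (deficit P (w ⊕ spread s (v ∷ vs))) ⟩
    (r P w v (s v) + Σr) + deficit P (w ⊕ spread s (v ∷ vs))  ∎
    where
    w′ = w ⊕ spread s vs
    Σr = sum (λ v → r P w v (s v)) vs
    w′v≤wv : val (w′ v) ≤ val (w v)
    w′v≤wv = ≤-trans (+-monoʳ-≤ (val (w v)) (spread-absent s v∉vs))
      (proj₁ (+-identityʳ (val (w v))))
    rearrange : ∀ x y z → x + (y + z) ≃ (y + x) + z
    rearrange x y z = pointwise-≃ λ k →
      solve 3 (λ x y z → x :+ (y :+ z) := (y :+ x) :+ z) refl (seq x k) (seq y k) (seq z k)

  -- Adding a blocking vector s node by node closes the whole deficit, and each
  -- node contributes at most its marginal gain at w.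
  deficit-≤-norm : ∀ {P x w s} c M → 0ℝ ≤ c → x ≤ᵛ w →
    All (λ p → T ≤ d (x ⊕ s) p) P → (∀ v y → c * r P w v y ≤ M * val y) →
    c * deficit P w ≤ M * ‖ s ‖
  deficit-≤-norm {P} {x} {w} {s} c M 0≤c x≤w blocked bound = begin
    c * deficit P w
      ≤⟨ *-monoˡ-≤ 0≤c (deficit-≤-sum P w s (allFin⁺ n)) ⟩
    c * (sum (λ v → r P w v (s v)) (allFin n) + deficit P (w ⊕ spread s (allFin n)))
      ≤⟨ *-monoˡ-≤ 0≤c (≤-trans (+-monoʳ-≤ _ closed) (proj₁ (+-identityʳ _))) ⟩
    c * sum (λ v → r P w v (s v)) (allFin n)
      ≈⟨ *-sum c (λ v → r P w v (s v)) (allFin n) ⟩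
    sum (λ v → c * r P w v (s v)) (allFin n)
      ≤⟨ sum-mono (allFin n) (λ {v} _ → bound v (s v)) ⟩
    sum (λ v → M * val (s v)) (allFin n)
      ≈⟨ *-sum M (λ v → val (s v)) (allFin n) ⟨
    M * ‖ s ‖  ∎
    where
    -- All of `s` is stacked on `w`, which is already above `x`; the result dominates `x ⊕ s` and so
    -- blocks every path.
    w* = w ⊕ spread s (allFin n)
    xs≤w* : x ⊕ s ≤ᵛ w*
    xs≤w* v = +-mono-≤ (x≤w v) (≤-spread s (∈-allFin v))
    closed : deficit P w* ≤ 0ℝ
    closed = begin
      deficit P w*          ≤⟨ sum-mono P (λ {p} p∈P → 0-bound (≤-trans
                                 (All.lookup blocked p∈P) (d-mono xs≤w* p))) ⟩
      sum (λ _ → 0ℝ) P      ≈⟨ sum-const 0ℝ P ⟩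
      fromℕ (length P) * 0ℝ ≈⟨ pointwise-≃ (λ _ → ℚ.*-zeroʳ (+ length P ℚ./ 1)) ⟩
      0ℝ                    ∎
      where
      0-bound : ∀ {y} → T ≤ y → T - y ≤ 0ℝ
      0-bound {y} T≤y = ≤-+⇒-≤ (≤-trans T≤y (x≤y+x y ≤-refl))

  -- Norms of single-node increments

  ⟨⟩-sum-absent : ∀ {v vs} y → All (v ≢_) vs → sum (λ u → val (⟨ v , y ⟩ u)) vs ≤ 0ℝ
  ⟨⟩-sum-absent y []           = ≤-refl
  ⟨⟩-sum-absent y (v≢u ∷ v∉vs) = ≤-trans
    (+-mono-≤ (proj₁ (val-≡ (⟨⟩-there y λ u≡v → v≢u (sym u≡v)))) (⟨⟩-sum-absent y v∉vs))
    (proj₁ (+-identityʳ 0ℝ))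

  ⟨⟩-sum : ∀ v {vs} y → Unique vs → sum (λ u → val (⟨ v , y ⟩ u)) vs ≤ val y
  ⟨⟩-sum v          y []             = nonNeg y
  ⟨⟩-sum v {u ∷ vs} y (u∉vs ∷ uniq) = cases (same-or-not u v)
    where
    cases : u ≡ v ⊎ u ≢ v → sum (λ u → val (⟨ v , y ⟩ u)) (u ∷ vs) ≤ val y
    cases (inj₁ refl) = ≤-trans
      (+-mono-≤ (proj₁ (val-≡ (⟨⟩-here v y))) (⟨⟩-sum-absent y u∉vs))
      (proj₁ (+-identityʳ (val y)))
    cases (inj₂ u≢v) = ≤-trans
      (+-mono-≤ (proj₁ (val-≡ (⟨⟩-there y u≢v))) (⟨⟩-sum v y uniq))
      (proj₁ (pointwise-≃ λ k → ℚ.+-identityˡ (seq (val y) k)))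

  ‖⊕⟨⟩‖-≤ : ∀ s v y → ‖ s ⊕ ⟨ v , y ⟩ ‖ ≤ ‖ s ‖ + val y
  ‖⊕⟨⟩‖-≤ s v y = begin
    ‖ s ⊕ ⟨ v , y ⟩ ‖        ≈⟨ sum-+ (λ u → val (s u)) (λ u → val (⟨ v , y ⟩ u)) (allFin n) ⟨
    ‖ s ‖ + ‖ ⟨ v , y ⟩ ‖    ≤⟨ +-monoʳ-≤ ‖ s ‖ (⟨⟩-sum v y (allFin⁺ n)) ⟩
    ‖ s ‖ + val y            ∎

  ‖𝟎‖≤0 : ‖ 𝟎 ‖ ≤ 0ℝ
  ‖𝟎‖≤0 = proj₁ (begin-equality
    ‖ 𝟎 ‖                         ≈⟨ sum-const 0ℝ (allFin n) ⟩
    fromℕ (length (allFin n)) * 0ℝ ≈⟨ pointwise-≃ (λ _ → ℚ.*-zeroʳ (+ length (allFin n) ℚ./ 1)) ⟩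
    0ℝ                            ∎)

  0≤‖_‖ : ∀ s → 0ℝ ≤ ‖ s ‖
  0≤‖ s ‖ = 0≤sum (allFin n) λ v → nonNeg (s v)

-- The run of the algorithm

module _ (𝒩 : Network) where
  open ThresholdBlocking 𝒩

  step-gain : ∀ {P w M v ŷ} → IsStep P w M v ŷ → M * val ŷ ≤ r P w v ŷ
  step-gain                         (maximum 0<ŷ M≤ _) = ≤÷⇒*≤ 0<ŷ M≤
  step-gain {P} {w} {M} {v} {ŷ}     (none _ ŷ≃0)       = begin
    M * val ŷ  ≈⟨ *-congˡ M ŷ≃0 ⟩
    M * 0ℝ     ≈⟨ pointwise-≃ (λ k → ℚ.*-zeroʳ (seq M k)) ⟩
    0ℝ         ≤⟨ 0≤r 𝒩 P w v ŷ ⟩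
    r P w v ŷ  ∎

  -- A total increment beyond `ŷ` fails the threshold in both cases of a step, by maximality or
  -- because every positive increment fails; refuting `M ≤` the quotient leaves the quotient at most
  -- `M`.
  step-maximal : ∀ {P w M v ŷ} → IsStep P w M v ŷ →
                 ∀ z → 0ℝ < val z → r P w v (ŷ +≥0 z) ≤ M * val (ŷ +≥0 z)
  step-maximal {ŷ = ŷ} isStep z 0<z = ÷≤⇒≤* 0<ŷ+z (≰⇒≥ (beyond isStep))
    where
    0<ŷ+z : 0ℝ < val (ŷ +≥0 z)
    0<ŷ+z = <-≤-trans 0<z (x≤y+x (val z) (nonNeg ŷ))
    ŷ<ŷ+z : val ŷ < val (ŷ +≥0 z)
    ŷ<ŷ+z = 0<ʳ-⇒< (<-≤-trans 0<z (proj₁ (pointwise-≃ λ k →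
      solve 2 (λ y z → z := (y :+ z) :- y) refl (seq (val ŷ) k) (seq (val z) k))))
    beyond : ∀ {P w M v} → IsStep P w M v ŷ → ¬ (M ≤ r P w v (ŷ +≥0 z) ÷ val (ŷ +≥0 z) by 0<ŷ+z)
    beyond (maximum _ _ max) M≤ = <⇒≱ ŷ<ŷ+z (max (ŷ +≥0 z) 0<ŷ+z M≤)
    beyond (none no-y _)     M≤ = no-y (ŷ +≥0 z) 0<ŷ+z M≤

  -- The first `ŷ` units gain at least `M` each on average and the total `ŷ + z` at most `M` each,
  -- so the further `z` units gain at most `M` each.
  step-sharp : ∀ {P w w′ M v ŷ} → IsStep P w M v ŷ →
               (∀ u → val (w′ u) ≃ val ((w ⊕ ⟨ v , ŷ ⟩) u)) →
               ∀ z → r P w′ v z ≤ M * val z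
  step-sharp {P} {w} {w′} {M} {v} {ŷ} isStep w′≃ = r-bound-extend 𝒩 P w′ v M λ z 0<z →
    +-cancelʳ-≤ (M * val ŷ) (begin
      r P w′ v z + M * val ŷ   ≤⟨ +-monoʳ-≤ (r P w′ v z) (step-gain isStep) ⟩
      r P w′ v z + r P w v ŷ   ≈⟨ +-comm (r P w′ v z) (r P w v ŷ) ⟩
      r P w v ŷ + r P w′ v z   ≤⟨ r-+ 𝒩 P ŷ z w′≃ ⟩
      r P w v (ŷ +≥0 z)        ≤⟨ step-maximal isStep z 0<z ⟩
      M * (val ŷ + val z)      ≈⟨ *-distribˡ-+ M (val ŷ) (val z) ⟩
      M * val ŷ + M * val z    ≈⟨ +-comm (M * val ŷ) (M * val z) ⟩
      M * val z + M * val ŷ    ∎)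

  module _ (I : Input) (order : List V) (order↭ : order ↭ allFin n)
           (η : ℝ) (0<η : 0ℝ < η) (η<1 : η < 1ℝ) where
    open Input I

    private
      c τ : ℝ
      c = 1ℝ - η
      τ = T * ε

      0<c : 0ℝ < c
      0<c = x<y⇒0<y-x η<1

      0≤c : 0ℝ ≤ c
      0≤c = <⇒≤ 0<c

      c*≤ : ∀ {y} → 0ℝ ≤ y → c * y ≤ y
      c*≤ {y} 0≤y = ≤-by (0≤*0≤ (<⇒≤ 0<η) 0≤y) λ k →
        solve 2 (λ η y → η :* y := y :- (con 1ℚ :- η) :* y) refl (seq η k) (seq y k)

    -- A node already treated in the current pass satisfies the sharp bound; the
    -- others inherit it from the previous pass, whose threshold was M / (1 - η).
    record Invariant (P : List Path) (s : Impact) (M : ℝ) (vs : List V) : Set where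
      field
        relaxed : ∀ v y → c * r P (x ⊕ s) v y ≤ M * val y
        sharp   : ∀ v y → v ∉ vs → r P (x ⊕ s) v y ≤ M * val y
    open Invariant

    -- Raising `v` may increase the marginal gain at `v` itself, so its old bound is discarded for
    -- `step-sharp`. The bounds at other nodes survive, as raising `v` and removing paths only lower
    -- their gains.
    invariant-step : ∀ {removed P′ P s M v vs ŷ} → IsStep P (x ⊕ s) M v ŷ →
      Interleaving removed P′ P → Invariant P s M (v ∷ vs) →
      Invariant P′ (s ⊕ ⟨ v , ŷ ⟩) M vs
    invariant-step {removed} {P′} {P} {s} {M} {v} {vs} {ŷ} isStep i inv = record
      { relaxed = λ u y → relaxed′ u y (same-or-not 𝒩 u v)
      ; sharp   = λ u y u∉vs → sharp′ u y u∉vs (same-or-not 𝒩 u v)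
      }
      where
      w  = x ⊕ s
      w′ = x ⊕ (s ⊕ ⟨ v , ŷ ⟩)
      w≤w′ : w ≤ᵛ w′
      w≤w′ u = +-monoʳ-≤ (val (x u)) (≤ᵛ-⊕ 𝒩 s ⟨ v , ŷ ⟩ u)
      at-v : ∀ y → r P′ w′ v y ≤ M * val y
      at-v y = ≤-trans (r-interleavingʳ-≤ 𝒩 w′ v y i)
        (step-sharp isStep (λ u → ≃-sym (⊕-assoc 𝒩 x s ⟨ v , ŷ ⟩ u)) y)
      away : ∀ {u} y → u ≢ v → r P′ w′ u y ≤ r P w u y
      away {u} y u≢v = ≤-trans (r-interleavingʳ-≤ 𝒩 w′ u y i)
        (r-diminishing 𝒩 P y w≤w′
          (+-monoʳ-≤ (val (x u)) (proj₁ (⊕-⟨⟩-there 𝒩 s ŷ u≢v))))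
      relaxed′ : ∀ u y → u ≡ v ⊎ u ≢ v → c * r P′ w′ u y ≤ M * val y
      relaxed′ u y (inj₁ refl) = ≤-trans (c*≤ (0≤r 𝒩 P′ w′ u y)) (at-v y)
      relaxed′ u y (inj₂ u≢v)  = ≤-trans (*-monoˡ-≤ 0≤c (away y u≢v)) (relaxed inv u y)
      sharp′ : ∀ u y → u ∉ vs → u ≡ v ⊎ u ≢ v → r P′ w′ u y ≤ M * val y
      sharp′ u y u∉vs (inj₁ refl) = at-v y
      sharp′ u y u∉vs (inj₂ u≢v)  = ≤-trans (away y u≢v)
        (sharp inv u y λ { (here u≡v) → u≢v u≡v ; (there u∈vs) → u∉vs u∈vs })

    -- At the end of a pass every node is sharp; multiplied by `c`, this is the relaxed bound for
    -- the new threshold `c * M`. The sharp part restarts vacuously, since `order` contains every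
    -- node.
    invariant-advance : ∀ {P s M} vs → Invariant P s M vs →
      Invariant P s (proj₁ (advance I order η M vs)) (proj₂ (advance I order η M vs))
    invariant-advance {P} {s} {M} [] inv = record
      { relaxed = λ v y → ≤-trans (*-monoˡ-≤ 0≤c (sharp inv v y λ ()))
                                  (proj₂ (*-assoc c M (val y)))
      ; sharp   = λ v y v∉order →
          contradiction (∈-resp-↭ (↭-sym order↭) (∈-allFin v)) v∉order
      }
    invariant-advance (v ∷ vs) inv = inv

    run-[] : ∀ {P s M vs out} → Run I order η P s M vs out → P ≡ [] → out ≡ s
    run-[] done                    _    = refl
    run-[] (step P≢[] _ _ _ _ _)   P≡[] = contradiction P≡[] P≢[]

    compound-0 : ∀ m → compound 0ℝ m ≃ 1ℝ
    compound-0 m = pointwise-≃ λ k → power k (suc m)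
      where
      t = fromℚ (+ 1 ℚ./ suc m)
      power : ∀ k j → seq ((1ℝ + 0ℝ * t) ^ j) k ≡ 1ℚ
      power k zero    = refl
      power k (suc j) = trans (cong₂ ℚ._*_
        (solve 1 (λ t → con 1ℚ :+ con 0ℚ :* t := con 1ℚ) refl (+ 1 ℚ./ suc m)) (power k j))
        (ℚ.*-identityʳ 1ℚ)

    module _ (0<T : 0ℝ < T) where

      0<τ : 0ℝ < τ
      0<τ = 0<*0< 0<T 0<ε

      -- A is the sum of the relative decreases of the deficit over all steps but
      -- the last; those decreases multiply to at least τ / Φ.
      run-bound : ∀ s* {P s M vs out} → Run I order η P s M vs out →
        P ≢ [] → Invariant P s M vs → All (λ p → T ≤ d (x ⊕ s*) p) P →
        0ℝ < deficit 𝒩 P (x ⊕ s) →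
        ∀ {Φ} → deficit 𝒩 P (x ⊕ s) ≤ Φ → τ ≤ Φ →
        ∃[ A ] 0ℝ ≤ A × c * ‖ out ‖ ≤ c * ‖ s ‖ + (1ℝ + A) * ‖ s* ‖ ×
          (∀ m → compound A m * τ ≤ Φ)
      run-bound _ done P≢[] _ _ _ _ _ = contradiction refl P≢[]
      run-bound s* {P} {s} {M} {_} {out}
        (step {removed = removed} {P′ = P′} {v = v} {vs = vs} {ŷ = ŷ} _ isStep i _ alive run)
        P≢[] inv blocked 0<φ {Φ} φ≤Φ τ≤Φ = continue P′ refl
        where
        w  = x ⊕ s
        s′ = s ⊕ ⟨ v , ŷ ⟩
        w′ = x ⊕ s′
        S  = ‖ s* ‖
        φ  = deficit 𝒩 P w
        φ′ = deficit 𝒩 P′ w′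
        Δ  = r P w v ŷ
        a  = Δ ÷ φ by 0<φ
        aφ≃Δ : a * φ ≃ Δ
        aφ≃Δ = ÷-*-cancel Δ 0<φ
        Δ+φ′≤φ : Δ + φ′ ≤ φ
        Δ+φ′≤φ = begin
          Δ + φ′                                ≤⟨ +-monoʳ-≤ Δ (sum-interleavingʳ-≤ _ (0≤T-d 𝒩 w′) i) ⟩
          Δ + deficit 𝒩 P w′                    ≤⟨ +-monoʳ-≤ Δ (deficit-anti 𝒩 P
                                                     λ u → proj₁ (⊕-assoc 𝒩 x s ⟨ v , ŷ ⟩ u)) ⟩
          Δ + deficit 𝒩 P (w ⊕ ⟨ v , ŷ ⟩)       ≈⟨ r+deficit 𝒩 P w v ŷ ⟩
          φ                                     ∎
        0≤φ′ : 0ℝ ≤ φ′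
        0≤φ′ = 0≤sum P′ (0≤T-d 𝒩 w′)
        0≤a : 0ℝ ≤ a
        0≤a = 0≤*0≤ (0≤r 𝒩 P w v ŷ) (0≤inv 0<φ)
        a≤1 : a ≤ 1ℝ
        a≤1 = *-cancelʳ-≤ 0<φ (begin
          a * φ    ≈⟨ aφ≃Δ ⟩
          Δ        ≤⟨ x≤x+y Δ 0≤φ′ ⟩
          Δ + φ′   ≤⟨ Δ+φ′≤φ ⟩
          φ        ≈⟨ *-identityˡ φ ⟨
          1ℝ * φ   ∎)
        -- `M` drops out as the middle term: the deficit is bounded above through `M * S` and the
        -- gain below through `M * val ŷ`.
        cŷ≤aS : c * val ŷ ≤ a * S
        cŷ≤aS = *-cancelʳ-≤ 0<φ (begin
          (c * val ŷ) * φ  ≈⟨ pointwise-≃ (λ k → solve 3 (λ c y φ → (c :* y) :* φ := y :* (c :* φ))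
                                refl (seq c k) (seq (val ŷ) k) (seq φ k)) ⟩
          val ŷ * (c * φ)  ≤⟨ *-monoˡ-≤ (nonNeg ŷ) (deficit-≤-norm 𝒩 c M 0≤c
                                (≤ᵛ-⊕ 𝒩 x s) blocked (relaxed inv)) ⟩
          val ŷ * (M * S)  ≈⟨ pointwise-≃ (λ k → solve 3 (λ y m s → y :* (m :* s) := (m :* y) :* s)
                                refl (seq (val ŷ) k) (seq M k) (seq S k)) ⟩
          (M * val ŷ) * S  ≤⟨ *-monoʳ-≤ (0≤‖_‖ 𝒩 s*) (step-gain isStep) ⟩
          Δ * S            ≈⟨ *-congʳ S aφ≃Δ ⟨
          (a * φ) * S      ≈⟨ pointwise-≃ (λ k → solve 3 (λ a φ s → (a :* φ) :* s := (a :* s) :* φ)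
                                refl (seq a k) (seq φ k) (seq S k)) ⟩
          (a * S) * φ      ∎)
        c‖s′‖≤ : c * ‖ s′ ‖ ≤ c * ‖ s ‖ + a * S
        c‖s′‖≤ = begin
          c * ‖ s′ ‖                ≤⟨ *-monoˡ-≤ 0≤c (‖⊕⟨⟩‖-≤ 𝒩 s v ŷ) ⟩
          c * (‖ s ‖ + val ŷ)       ≈⟨ *-distribˡ-+ c ‖ s ‖ (val ŷ) ⟩
          c * ‖ s ‖ + c * val ŷ     ≤⟨ +-monoʳ-≤ (c * ‖ s ‖) cŷ≤aS ⟩
          c * ‖ s ‖ + a * S         ∎
        Goal : Set
        Goal = ∃[ A ] 0ℝ ≤ A × c * ‖ out ‖ ≤ c * ‖ s ‖ + (1ℝ + A) * S ×
          (∀ m → compound A m * τ ≤ Φ)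
        -- This step contributes `a ≤ 1` to the norm and nothing to `A`.
        last-step : out ≡ s′ → Goal
        last-step refl = 0ℝ , ≤-refl
          , ≤-trans c‖s′‖≤ (+-monoʳ-≤ (c * ‖ s ‖) (*-monoʳ-≤ (0≤‖_‖ 𝒩 s*)
              (≤-trans a≤1 (x≤x+y 1ℝ ≤-refl))))
          , λ m → begin
              compound 0ℝ m * τ  ≈⟨ *-congʳ τ (compound-0 m) ⟩
              1ℝ * τ             ≈⟨ *-identityˡ τ ⟩
              τ                  ≤⟨ τ≤Φ ⟩
              Φ                  ∎
        further-steps : ∀ {p} → p ∈ P′ → P′ ≢ [] → Goal
        further-steps {p} p∈P′ P′≢[] =
          -- From here on `Φ` can be the deficit itself, since a surviving path keeps it at least
          -- `τ`. At the start the paths may already be almost blocked and the deficit below `τ`,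
          -- hence a separate `Φ`.
          let A , 0≤A , norm , power = run-bound s* run P′≢[]
                (invariant-advance vs (invariant-step isStep i inv))
                (All-interleavingʳ i blocked) (<-≤-trans 0<τ τ≤φ′) ≤-refl τ≤φ′
          in a + A , ≤-trans 0≤a (x≤x+y a 0≤A) , (begin
               c * ‖ out ‖                              ≤⟨ norm ⟩
               c * ‖ s′ ‖ + (1ℝ + A) * S                ≤⟨ +-monoˡ-≤ ((1ℝ + A) * S) c‖s′‖≤ ⟩
               (c * ‖ s ‖ + a * S) + (1ℝ + A) * S       ≈⟨ collect (c * ‖ s ‖) a A S ⟩
               c * ‖ s ‖ + (1ℝ + (a + A)) * S           ∎) ,
             -- `(1ℝ - a) * φ` is cancelled as a whole because its positivity is at hand: it
             -- dominates `φ′`, which is at least `τ`.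
             λ m → ≤-trans (*-cancelʳ-≤ {z = (1ℝ - a) * φ} (<-≤-trans (<-≤-trans 0<τ τ≤φ′) φ′≤)
               (begin
                 (compound (a + A) m * τ) * ((1ℝ - a) * φ)
                   ≈⟨ regroup (compound (a + A) m) τ (1ℝ - a) φ ⟩
                 ((compound (a + A) m * (1ℝ - a)) * τ) * φ
                   ≤⟨ *-monoʳ-≤ (<⇒≤ 0<φ) (≤-trans
                        (*-monoʳ-≤ (<⇒≤ 0<τ) (compound-decay m 0≤A 0≤a)) (power m)) ⟩
                 φ′ * φ              ≤⟨ *-monoʳ-≤ (<⇒≤ 0<φ) φ′≤ ⟩
                 ((1ℝ - a) * φ) * φ  ≈⟨ *-comm ((1ℝ - a) * φ) φ ⟩
                 φ * ((1ℝ - a) * φ)  ∎)) φ≤Φ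
          where
          τ≤φ′ : τ ≤ φ′
          τ≤φ′ = ≤-trans
            (≤-by (≤⇒0≤ʳ- (≰⇒≥ (All.lookup alive p∈P′))) λ k →
              solve 3 (λ t e d → t :* (con 1ℚ :- e) :- d := (t :- d) :- t :* e) refl
                (seq T k) (seq ε k) (seq (d w′ p) k))
            (term≤sum (0≤T-d 𝒩 w′) p∈P′)
          φ′≤ : φ′ ≤ (1ℝ - a) * φ
          φ′≤ = +-cancelʳ-≤ Δ (begin
            φ′ + Δ                    ≈⟨ +-comm φ′ Δ ⟩
            Δ + φ′                    ≤⟨ Δ+φ′≤φ ⟩
            φ                         ≈⟨ pointwise-≃ (λ k → solve 2 (λ a φ →
                φ := (con 1ℚ :- a) :* φ :+ a :* φ) refl (seq a k) (seq φ k)) ⟩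
            (1ℝ - a) * φ + a * φ      ≈⟨ +-cong ≃-refl aφ≃Δ ⟩
            (1ℝ - a) * φ + Δ          ∎)
          collect : ∀ y a A S → (y + a * S) + (1ℝ + A) * S ≃ y + (1ℝ + (a + A)) * S
          collect y a A S = pointwise-≃ λ k → solve 4 (λ y a A S →
            (y :+ a :* S) :+ (con 1ℚ :+ A) :* S := y :+ (con 1ℚ :+ (a :+ A)) :* S) refl
            (seq y k) (seq a k) (seq A k) (seq S k)
          regroup : ∀ X t b φ → (X * t) * (b * φ) ≃ ((X * b) * t) * φ
          regroup X t b φ = pointwise-≃ λ k → solve 4 (λ X t b φ →
            (X :* t) :* (b :* φ) := ((X :* b) :* t) :* φ) refl
            (seq X k) (seq t k) (seq b k) (seq φ k)
        continue : ∀ Q → Q ≡ P′ → Goal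
        continue []      eq = last-step (run-[] run (sym eq))
        continue (p ∷ Q) eq = further-steps (subst (p ∈_) eq (here refl))
          λ P′≡[] → contradiction (trans eq P′≡[]) λ ()

    -- There is no earlier pass to inherit from; the bound on `M₀` gives the sharp inequality at
    -- every node, and the relaxed one follows from `c ≤ 1`.
    invariant-start : ∀ {M₀} →
      (∀ w → x ≤ᵛ w → ∀ v y (0<y : 0ℝ < val y) → r 𝒫 w v y ÷ val y by 0<y ≤ M₀) →
      Invariant 𝒫 𝟎 M₀ order
    invariant-start {M₀} bound = record
      { relaxed = λ v y → ≤-trans (c*≤ (0≤r 𝒩 𝒫 (x ⊕ 𝟎) v y)) (bounded₀ v y)
      ; sharp   = λ v y _ → bounded₀ v y
      }
      where
      bounded₀ : ∀ v y → r 𝒫 (x ⊕ 𝟎) v y ≤ M₀ * val y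
      bounded₀ v = r-bound-extend 𝒩 𝒫 (x ⊕ 𝟎) v M₀ λ y 0<y →
        ÷≤⇒≤* 0<y (bound (x ⊕ 𝟎) (≤ᵛ-⊕ 𝒩 x 𝟎) v y 0<y)

    -- Treated apart because the argument of the logarithm is 0 here. The zero vector blocks
    -- vacuously, so minimality forces `‖ s* ‖` to 0 and any coefficient `K` will do.
    bound-empty : ∀ {s s* M} K → 𝒫 ≡ [] → ThresholdExpansion I order η M s →
                  Optimal I s* → ‖ s ‖ ≤ K * ‖ s* ‖
    bound-empty {s* = s*} K 𝒫≡[] run (_ , minimal) = vanish (run-[] run 𝒫≡[])
      where
      ‖s*‖≃0 : ‖ s* ‖ ≃ 0ℝ
      ‖s*‖≃0 = ≤-trans (minimal 𝟎 λ p∈𝒫 → contradiction (subst (_ ∈_) 𝒫≡[] p∈𝒫) λ ())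
        (‖𝟎‖≤0 𝒩) , 0≤‖_‖ 𝒩 s*
      vanish : ∀ {s} → s ≡ 𝟎 → ‖ s ‖ ≤ K * ‖ s* ‖
      vanish refl = begin
        ‖ 𝟎 ‖       ≤⟨ ‖𝟎‖≤0 𝒩 ⟩
        0ℝ          ≈⟨ pointwise-≃ (λ k → ℚ.*-zeroʳ (seq K k)) ⟨
        K * 0ℝ      ≈⟨ *-congˡ K ‖s*‖≃0 ⟨
        K * ‖ s* ‖  ∎

    bound-nonempty : ∀ {p M₀ s s* L} → p ∈ 𝒫 →
      (∀ w → x ≤ᵛ w → ∀ v y (0<y : 0ℝ < val y) → r 𝒫 w v y ÷ val y by 0<y ≤ M₀) →
      ThresholdExpansion I order η M₀ s → Blocks I s* →
      IsLn (fromℕ (length 𝒫) * inv ε 0<ε) L →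
      ‖ s ‖ ≤ ((L + 1ℝ) ÷ c by 0<c) * ‖ s* ‖
    bound-nonempty {p} {M₀} {s} {s*} {L} p∈𝒫 bound run blocks isLn =
      let A , 0≤A , norm , power = run-bound 0<T s* run
            (λ 𝒫≡[] → contradiction (subst (p ∈_) 𝒫≡[] p∈𝒫) λ ())
            (invariant-start bound) (All.tabulate blocks) 0<φ φ≤Φ τ≤Φ
      in conclude A 0≤A norm power
      where
      N z Φ S : ℝ
      N = fromℕ (length 𝒫)
      z = N * inv ε 0<ε
      Φ = N * T
      S = ‖ s* ‖
      -- Feasibility of one path yields this: its weight under `𝟎` is nonnegative and below `T`.
      0<T : 0ℝ < T
      0<T = let open Feasible (All.lookup feasible p∈𝒫) in
        ≤-<-trans (0≤weight 𝒩 𝟎 p) weight<T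
        where
        ≤-<-trans : ∀ {x y z} → x ≤ y → y < z → x < z
        ≤-<-trans {x} {y} {z} x≤y y<z = 0<ʳ-⇒< (<-≤-trans (x<y⇒0<y-x y<z)
          (+-monoʳ-≤ z (-‿anti-≤ x≤y)))
      0<φ : 0ℝ < deficit 𝒩 𝒫 (x ⊕ 𝟎)
      0<φ = <-≤-trans (x<y⇒0<y-x (All.lookup unblocked p∈𝒫)) (≤-trans
        (+-monoʳ-≤ T (-‿anti-≤ (d-mono 𝒩 (λ v → proj₁ (+-identityʳ (val (x v)))) p)))
        (term≤sum (0≤T-d 𝒩 (x ⊕ 𝟎)) p∈𝒫))
      φ≤Φ : deficit 𝒩 𝒫 (x ⊕ 𝟎) ≤ Φ
      φ≤Φ = ≤-trans (sum-mono 𝒫 λ {q} _ → ≤-+⇒-≤ (x≤x+y T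
          (⊓-glb (0≤weight 𝒩 (x ⊕ 𝟎) q) (<⇒≤ 0<T))))
        (proj₁ (sum-const T 𝒫))
      1≤N : 1ℝ ≤ N
      1≤N = pointwise-≤ λ _ → /1-mono-≤ {1} {length 𝒫} (positive p∈𝒫)
        where
        positive : ∀ {P : List Path} → p ∈ P → 1 ℕ.≤ length P
        positive {_ ∷ _} _ = ℕ.s≤s ℕ.z≤n
      τ≤Φ : τ ≤ Φ
      τ≤Φ = begin
        T * ε   ≤⟨ *-monoˡ-≤ (<⇒≤ 0<T) (≤-trans (<⇒≤ ε<1) 1≤N) ⟩
        T * N   ≈⟨ *-comm T N ⟩
        N * T   ∎
      conclude : ∀ A → 0ℝ ≤ A → c * ‖ s ‖ ≤ c * ‖ 𝟎 ‖ + (1ℝ + A) * S →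
                 (∀ m → compound A m * τ ≤ Φ) → ‖ s ‖ ≤ ((L + 1ℝ) ÷ c by 0<c) * S
      conclude A 0≤A norm power = *-cancelʳ-≤ 0<c (begin
        ‖ s ‖ * c                         ≈⟨ *-comm ‖ s ‖ c ⟩
        c * ‖ s ‖                         ≤⟨ norm ⟩
        c * ‖ 𝟎 ‖ + (1ℝ + A) * S          ≤⟨ +-mono-≤ (*-monoˡ-≤ 0≤c (‖𝟎‖≤0 𝒩))
                                               (*-monoʳ-≤ (0≤‖_‖ 𝒩 s*) (+-monoʳ-≤ 1ℝ A≤L)) ⟩
        c * 0ℝ + (1ℝ + L) * S             ≈⟨ pointwise-≃ (λ k → solve 3 (λ c L S →
            c :* con 0ℚ :+ (con 1ℚ :+ L) :* S := (L :+ con 1ℚ) :* S) refl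
            (seq c k) (seq L k) (seq S k)) ⟩
        (L + 1ℝ) * S                      ≈⟨ *-congʳ S (÷-*-cancel (L + 1ℝ) 0<c) ⟨
        (((L + 1ℝ) ÷ c by 0<c) * c) * S   ≈⟨ pointwise-≃ (λ k → solve 3 (λ q c S →
            (q :* c) :* S := (q :* S) :* c) refl
            (seq ((L + 1ℝ) ÷ c by 0<c) k) (seq c k) (seq S k)) ⟩
        (((L + 1ℝ) ÷ c by 0<c) * S) * c   ∎)
        where
        compound≤z : ∀ m → compound A m ≤ z
        compound≤z m = *-cancelʳ-≤ (0<τ 0<T) (begin
          compound A m * τ                   ≤⟨ power m ⟩
          N * T                              ≈⟨ *-congʳ T (÷-*-cancel N 0<ε) ⟨
          (z * ε) * T                        ≈⟨ pointwise-≃ (λ k → solve 3 (λ z e t →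
              (z :* e) :* t := z :* (t :* e)) refl (seq z k) (seq ε k) (seq T k)) ⟩
          z * τ                              ∎)
        0<z : 0ℝ < z
        0<z = <-≤-trans 0<1 (≤-trans 1≤compound (compound≤z 0))
          where
          0<1 : 0ℝ < 1ℝ
          0<1 = mk< 1ℚ (ℚ.positive⁻¹ 1ℚ) 0 λ _ _ → ℚ.≤-reflexive (ℚ.+-identityˡ 1ℚ)
          1≤compound : 1ℝ ≤ compound A 0
          1≤compound = ≤-trans (x≤x+y 1ℝ (0≤*0≤ 0≤A (0≤1/suc 0))) (proj₂ (*-identityʳ _))
        A≤L : A ≤ L
        A≤L = compound≤exp 0<z isLn compound≤z

theorem2 : (𝒩 : Network) → let open ThresholdBlocking 𝒩 in
    (I : Input) → let open Input I in
    (order : List V) → order ↭ allFin n →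
    (η : ℝ) → 0ℝ < η → (η<1 : η < 1ℝ) →
    (M₀ : ℝ) →
    (∀ w → x ≤ᵛ w → ∀ v y (0<y : 0ℝ < val y) → r 𝒫 w v y ÷ val y by 0<y ≤ M₀) →
    (s s* : Impact) → ThresholdExpansion I order η M₀ s → Optimal I s* →
    (L : ℝ) → IsLn (fromℕ (length 𝒫) * inv ε 0<ε) L →
    ‖ s ‖ ≤ ((L + 1ℝ) ÷ (1ℝ - η) by x<y⇒0<y-x η<1) * ‖ s* ‖
theorem2 𝒩 I order order↭ η 0<η η<1 M₀ bound s s* run optimal L isLn = cases 𝒫 refl
  where
  open ThresholdBlocking 𝒩
  open Input I
  cases : ∀ P → P ≡ 𝒫 → ‖ s ‖ ≤ ((L + 1ℝ) ÷ (1ℝ - η) by x<y⇒0<y-x η<1) * ‖ s* ‖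
  cases []      eq = bound-empty 𝒩 I order order↭ η 0<η η<1 _ (sym eq) run optimal
  cases (p ∷ P) eq = bound-nonempty 𝒩 I order order↭ η 0<η η<1
    (subst (p ∈_) eq (here refl)) bound run (proj₁ optimal) isLn
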